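{- The maximum order $n$ of an Abelian group $\Gamma$ having a covering difference set $S$ of cardinality $s=7$ is $n=39$. The set $S=\{0,1,2,4,13,18,33\}$ in $\mathbb{Z}_{39}$ provides a $(39,7,1,34)$ almost difference set (in particular it is a covering difference set of $\mathbb{Z}_{39}$).
   Context: Let $\Gamma$ be a finite Abelian group (written additively) and $S\subseteq\Gamma$. $S$ is a covering difference set (covering set) of $\Gamma$ if every element of $\Gamma$ is of the form $t-t'$ for some $t,t'\in S$. An $(n,s,\lambda,t)$-almost difference set (ADS) is a subset $S$ of size $s$ of a group of order $n$ such that the multiset of differences of elements of $S$ contains exactly $t$ of the non-identity group elements exactly $\lambda$ times each, and all other non-identity group elements exactly $\lambda+1$ times each. -}

module Defs where

open import Algebra.Bundles using (AbelianGroup)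
open import Algebra.Structures using (IsAbelianGroup)
open import Data.Fin.Base using (Fin; toℕ)
open import Data.Fin.Properties using (toℕ-injective; toℕ-fromℕ<; toℕ<n; toℕ≤n)
import Data.Fin.Properties as Fin
open import Data.List.Base using (List; length; filter; map; allFin; cartesianProductWith)
import Data.List.Membership.Setoid as Membership
import Data.List.Relation.Unary.Unique.Setoid as Unique
open import Data.Nat.Base using (ℕ; suc; _+_; _∸_; _≤_; NonZero; >-nonZero⁻¹)
open import Data.Nat.DivMod using (_%_; _mod_; m%n<n; m%n%n≡m%n; m<n⇒m%n≡m; n%n≡0; %-distribˡ-+)
import Data.Nat.Properties as ℕ
open import Data.Product.Base using (Σ-syntax; ∃₂; _×_; _,_)
open import Data.Sum.Base using (_⊎_)
open import Function.Bundles using (Inverse)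
open import Function.Construct.Identity using () renaming (inverse to idInverse)
open import Function.Construct.Symmetry using () renaming (inverse to symInverse)
open import Function.Properties.Inverse using (Inverse⇒Injection)
open import Level using (Level; 0ℓ; _⊔_) renaming (suc to lsuc)
open import Relation.Binary.Definitions using (Decidable)
open import Relation.Binary.PropositionalEquality
  using (_≡_; sym; trans; cong; cong₂; isEquivalence; module ≡-Reasoning)
  renaming (setoid to ≡-setoid)
open import Relation.Nullary.Decidable using (via-injection; ¬?; _×-dec_)
open import Relation.Unary using (Pred)

private
  variable
    c ℓ p : Level

record FiniteAbelianGroup (c ℓ : Level) : Set (lsuc (c ⊔ ℓ)) where
  field
    abelianGroup : AbelianGroup c ℓ

  -- The library writes the group multiplicatively (_∙_, ε, _⁻¹), except
  -- that x - y abbreviates x ∙ y ⁻¹.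
  open AbelianGroup abelianGroup public

  field
    order       : ℕ
    enumeration : Inverse (≡-setoid (Fin order)) setoid

  infix 4 _≟_

  _≟_ : Decidable _≈_
  _≟_ = via-injection (Inverse⇒Injection (symInverse enumeration)) Fin._≟_

  -- Each group element is listed exactly once.
  elements : List Carrier
  elements = map (Inverse.to enumeration) (allFin order)

-- A subset of Γ is represented by a list of its elements, required to be
-- repetition-free (up to the group's equality) by HasSize.
module _ (Γ : FiniteAbelianGroup c ℓ) where

  open FiniteAbelianGroup Γ renaming (setoid to Γ-setoid)
  open Membership Γ-setoid using (_∈_)
  open Unique Γ-setoid using (Unique)

  HasSize : List Carrier → ℕ → Set (c ⊔ ℓ)
  HasSize S s = Unique S × length S ≡ s

  IsCoveringSet : List Carrier → Set (c ⊔ ℓ)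
  IsCoveringSet S = ∀ g → ∃₂ λ t t′ → t ∈ S × t′ ∈ S × g ≈ t - t′

  multiplicity : Carrier → List Carrier → ℕ
  multiplicity g xs = length (filter (g ≟_) xs)

  -- As a multiset.  It includes the differences t - t, which affect only
  -- the multiplicity of the identity.
  differences : List Carrier → List Carrier
  differences S = cartesianProductWith _-_ S S

  nonIdentityWithMultiplicity : ℕ → List Carrier → List Carrier
  nonIdentityWithMultiplicity k xs =
    filter (λ g → ¬? (g ≟ ε) ×-dec (multiplicity g xs ℕ.≟ k)) elements

  record IsAlmostDifferenceSet (S : List Carrier) (n s λ′ t : ℕ) : Set (c ⊔ ℓ) where
    field
      group-order   : order ≡ n
      size          : HasSize S s
      exactly-t     : length (nonIdentityWithMultiplicity λ′ (differences S)) ≡ t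
      λ-or-suc-λ    : ∀ g → g ≉ ε →
                      multiplicity g (differences S) ≡ λ′ ⊎
                      multiplicity g (differences S) ≡ suc λ′

HasGroupWithCoveringSet : (c ℓ : Level) → ℕ → ℕ → Set (lsuc (c ⊔ ℓ))
HasGroupWithCoveringSet c ℓ s n =
  Σ[ Γ ∈ FiniteAbelianGroup c ℓ ]
  Σ[ S ∈ List (FiniteAbelianGroup.Carrier Γ) ]
    FiniteAbelianGroup.order Γ ≡ n × HasSize Γ S s × IsCoveringSet Γ S

IsMaximumOf : Pred ℕ p → ℕ → Set p
IsMaximumOf P n = P n × (∀ m → P m → m ≤ n)

-- The integers modulo n, on the residues 0, …, n - 1.
module _ (n : ℕ) .{{_ : NonZero n}} where

  private
    add : Fin n → Fin n → Fin n
    add i j = (toℕ i + toℕ j) mod n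

    zeroMod : Fin n
    zeroMod = 0 mod n

    negate : Fin n → Fin n
    negate i = (n ∸ toℕ i) mod n

    toℕ-mod : ∀ a → toℕ (a mod n) ≡ a % n
    toℕ-mod a = toℕ-fromℕ< (m%n<n a n)

    toℕ-% : ∀ (i : Fin n) → toℕ i % n ≡ toℕ i
    toℕ-% i = m<n⇒m%n≡m (toℕ<n i)

    %-absorbˡ : ∀ a b → (a % n + b) % n ≡ (a + b) % n
    %-absorbˡ a b = begin
      (a % n + b) % n          ≡⟨ %-distribˡ-+ (a % n) b n ⟩
      (a % n % n + b % n) % n  ≡⟨ cong (λ x → (x + b % n) % n) (m%n%n≡m%n a n) ⟩
      (a % n + b % n) % n      ≡⟨ %-distribˡ-+ a b n ⟨
      (a + b) % n              ∎
      where open ≡-Reasoning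

    mod-absorbˡ : ∀ a b → (toℕ (a mod n) + b) mod n ≡ (a + b) mod n
    mod-absorbˡ a b = toℕ-injective (begin
      toℕ ((toℕ (a mod n) + b) mod n)  ≡⟨ toℕ-mod _ ⟩
      (toℕ (a mod n) + b) % n          ≡⟨ cong (λ x → (x + b) % n) (toℕ-mod a) ⟩
      (a % n + b) % n                  ≡⟨ %-absorbˡ a b ⟩
      (a + b) % n                      ≡⟨ toℕ-mod _ ⟨
      toℕ ((a + b) mod n)              ∎)
      where open ≡-Reasoning

    add-comm : ∀ i j → add i j ≡ add j i
    add-comm i j = cong (_mod n) (ℕ.+-comm (toℕ i) (toℕ j))

    add-assoc : ∀ i j k → add (add i j) k ≡ add i (add j k)
    add-assoc i j k = begin
      add (add i j) k                  ≡⟨ mod-absorbˡ (toℕ i + toℕ j) (toℕ k) ⟩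
      (toℕ i + toℕ j + toℕ k) mod n    ≡⟨ cong (_mod n) (ℕ.+-assoc (toℕ i) (toℕ j) (toℕ k)) ⟩
      (toℕ i + (toℕ j + toℕ k)) mod n  ≡⟨ cong (_mod n) (ℕ.+-comm (toℕ i) (toℕ j + toℕ k)) ⟩
      (toℕ j + toℕ k + toℕ i) mod n    ≡⟨ mod-absorbˡ (toℕ j + toℕ k) (toℕ i) ⟨
      add (add j k) i                  ≡⟨ add-comm (add j k) i ⟩
      add i (add j k)                  ∎
      where open ≡-Reasoning

    add-identityˡ : ∀ i → add zeroMod i ≡ i
    add-identityˡ i = trans (mod-absorbˡ 0 (toℕ i))
      (toℕ-injective (trans (toℕ-mod (toℕ i)) (toℕ-% i)))

    add-inverseˡ : ∀ i → add (negate i) i ≡ zeroMod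
    add-inverseˡ i = begin
      add (negate i) i               ≡⟨ mod-absorbˡ (n ∸ toℕ i) (toℕ i) ⟩
      (n ∸ toℕ i + toℕ i) mod n      ≡⟨ cong (_mod n) (ℕ.m∸n+n≡m (toℕ≤n i)) ⟩
      n mod n                        ≡⟨ toℕ-injective n≡0 ⟩
      zeroMod                        ∎
      where
      open ≡-Reasoning
      n≡0 : toℕ (n mod n) ≡ toℕ zeroMod
      n≡0 = trans (toℕ-mod n) (trans (n%n≡0 n)
        (sym (trans (toℕ-mod 0) (m<n⇒m%n≡m (>-nonZero⁻¹ n)))))

    isAbelianGroup : IsAbelianGroup _≡_ add zeroMod negate
    isAbelianGroup = record
      { isGroup = record
        { isMonoid = record
          { isSemigroup = record
            { isMagma = record { isEquivalence = isEquivalence ; ∙-cong = cong₂ add }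
            ; assoc   = add-assoc
            }
          ; identity = add-identityˡ , λ i → trans (add-comm i zeroMod) (add-identityˡ i)
          }
        ; inverse = add-inverseˡ , λ i → trans (add-comm i (negate i)) (add-inverseˡ i)
        ; ⁻¹-cong = cong negate
        }
      ; comm = add-comm
      }

  ℤ/_ : FiniteAbelianGroup 0ℓ 0ℓ
  ℤ/_ = record
    { abelianGroup = record { isAbelianGroup = isAbelianGroup }
    ; order        = n
    ; enumeration  = idInverse (≡-setoid (Fin n))
    }

{-# OPTIONS --safe #-}

-- Let N be the number of solutions of 2x = 0.  Among the 49 differences of S
-- the identity occurs 7 times, every involution at least twice (g = t - t′ is
-- also t′ - t) and every other element at least once, so n + N + 5 ≤ 49.  In
-- particular n ≤ 43, and the orders 40, …, 43 are excluded as follows.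
--
-- Cyclic groups of order 40, 41 and 43: translate S so that it contains 0 and 1.
-- The 21 pairs of elements of S have to cover all classes {d , -d}, d ≠ 0, so at
-- most one class (none if n = 43) occurs twice, and a backtracking search which
-- keeps track of this budget finds no S.
--
-- Order 42: N = 2, so x ↦ 21x maps onto a group of order 2.  If S has a and b
-- elements over its two elements then a + b = 7, 2ab ≥ 21 and a² + b² ≥ 27.
--
-- Order 40: doubling three times shows that 8x = 0 has 8 solutions and that x ↦ 8x
-- has an image of order 5.  If N = 4, counting the differences of S over the
-- elements of that image contradicts a finite check on the 5 multiplicities.
-- Otherwise there is an x of order 8, and x + 8z generates the group if 8z ≠ 0.
module Submission where

open import Defs
open import Algebra.Bundles using (AbelianGroup; RawGroup)
open import Algebra.Core using (Op₁; Op₂)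
import Algebra.Morphism.GroupMonomorphism as GroupMonomorphism
open import Algebra.Morphism.Structures using (IsGroupMonomorphism)
import Algebra.Properties.AbelianGroup
import Algebra.Properties.CommutativeMonoid.Mult
import Algebra.Properties.CommutativeMonoid.Sum
import Algebra.Properties.Semiring.Sum
open import Algebra.Structures using (IsAbelianGroup)
open import Data.Bool.Base using (Bool; true; false; T; _∧_; if_then_else_)
open import Data.Bool.ListAction using (any)
open import Data.Bool.Properties using (T-∧; T-≡)
open import Data.Fin using (Fin; #_)
open import Data.Fin.Base using (zero; suc; toℕ)
import Data.Fin.Base as Fin
open import Data.Fin.Patterns using (0F; 1F; 2F; 3F; 4F)
open import Data.Fin.Permutation using (Permutation′; permutation)
open import Data.Fin.Properties using (any?; toℕ-injective; toℕ<n; toℕ-fromℕ<) renaming (_≟_ to _≟ᶠ_)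
import Data.Fin.Properties as Fin
open import Data.List.Base using (List; []; _∷_; _++_; length; map; filter; applyUpTo; upTo; tabulate; lookup)
open import Data.List.Membership.Propositional using (_∈_)
open import Data.List.Membership.Propositional.Properties
  using (∈-∃++; ∈-++⁺ˡ; ∈-++⁺ʳ; ∈-++⁻; ∈-map⁺; ∈-tabulate⁺; ∈-filter⁻; ∈-applyUpTo⁻; ∈-upTo⁺)
import Data.List.Membership.Setoid as Membership
open import Data.List.Membership.Setoid.Properties using () renaming (∈-map⁺ to ∈ₛ-map⁺)
open import Data.List.Properties using (length-++; length-map; length-tabulate; length-applyUpTo; filter-accept)
open import Data.List.Relation.Binary.Subset.Propositional using (_⊆_)
open import Data.List.Relation.Unary.All as All using (All; []; _∷_; lookupAny)
open import Data.List.Relation.Unary.AllPairs as AllPairs using ([]; _∷_; allPairs?)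
import Data.List.Relation.Unary.AllPairs.Properties as AllPairs
open import Data.List.Relation.Unary.Any as Any using (Any; here; there; index)
open import Data.List.Relation.Unary.Any.Properties using (any⁻; lookup-index)
open import Data.List.Relation.Unary.Unique.DecPropositional using (unique?)
open import Data.List.Relation.Unary.Unique.Propositional using (Unique)
import Data.List.Relation.Unary.Unique.Propositional.Properties as Unique
open import Data.Nat.Base
open import Data.Nat.Divisibility using (_∣_; _∣?_; divides; ∣⇒≤)
open import Data.Nat.DivMod using (_mod_; m%n<n; m<n⇒m%n≡m; m≤n⇒[n∸m]%m≡n%m; m≡m%n+[m/n]*n)
open import Data.Nat.GCD using (gcd; gcd[m,n]∣m; gcd[m,n]∣n; gcd-GCD; module Bézout)
open import Data.Nat.Properties hiding (_≟_)
import Data.Nat.Properties as ℕ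
open import Data.Product.Base using (_×_; _,_; proj₁; proj₂; ∃; ∃₂)
open import Data.Sum.Base using (_⊎_; inj₁; inj₂; [_,_]′)
open import Function.Base using (_∘_; const; id)
open import Function.Bundles using (Inverse; module Equivalence)
open import Function.Definitions using (Injective)
open import Level using (Level; Lift; lift; lower; 0ℓ)
open import Relation.Binary.Definitions using (tri<; tri≈; tri>)
open import Relation.Binary.PropositionalEquality
  using (_≡_; _≢_; refl; sym; trans; cong; cong₂; subst; subst₂; module ≡-Reasoning)
open import Relation.Nullary.Decidable
  using (Dec; yes; no; does; ¬?; _×-dec_; _⊎-dec_; _→-dec_; from-yes)
open import Relation.Nullary.Negation using (¬_; contradiction)
open import Relation.Unary using (Pred; Decidable)

open Algebra.Properties.Semiring.Sum +-*-semiring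
  using (sum; sum-cong-≗; sum-permute; ∑-comm; ∑-distrib-+; *-distribˡ-sum; *-distribʳ-sum)

-- Indicator sums and counting over `Fin n`

module Counting where

  private
    variable
      p : Level
      X Y : Set p
      m n : ℕ

  𝟙 : Dec X → ℕ
  𝟙 d = if does d then 1 else 0

  𝟙-yes : (d : Dec X) → X → 𝟙 d ≡ 1
  𝟙-yes (yes _)  _  = refl
  𝟙-yes (no ¬p)  p  = contradiction p ¬p

  𝟙-no : (d : Dec X) → ¬ X → 𝟙 d ≡ 0
  𝟙-no (yes p) ¬p = contradiction p ¬p
  𝟙-no (no _)  _  = refl

  𝟙≤1 : (d : Dec X) → 𝟙 d ≤ 1
  𝟙≤1 (yes _) = ≤-refl
  𝟙≤1 (no _)  = z≤n

  𝟙-mono : (d : Dec X) (e : Dec Y) → (X → Y) → 𝟙 d ≤ 𝟙 e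
  𝟙-mono (no _)  e f = z≤n
  𝟙-mono (yes p) e f = ≤-reflexive (sym (𝟙-yes e (f p)))

  𝟙-cong : (d : Dec X) (e : Dec Y) → (X → Y) → (Y → X) → 𝟙 d ≡ 𝟙 e
  𝟙-cong d e f g = ≤-antisym (𝟙-mono d e f) (𝟙-mono e d g)

  𝟙-× : (d : Dec X) (e : Dec Y) → 𝟙 (d ×-dec e) ≡ 𝟙 d * 𝟙 e
  𝟙-× (no _)  e       = refl
  𝟙-× (yes _) (no _)  = refl
  𝟙-× (yes _) (yes _) = refl

  sum-mono : {f g : Fin n → ℕ} → (∀ i → f i ≤ g i) → sum f ≤ sum g
  sum-mono {n = zero}  f≤g = z≤n
  sum-mono {n = suc n} f≤g = +-mono-≤ (f≤g zero) (sum-mono (f≤g ∘ suc))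

  sum-const : ∀ n k → sum {n} (const k) ≡ n * k
  sum-const zero    k = refl
  sum-const (suc n) k = cong (k +_) (sum-const n k)

  sum-zero : {f : Fin n → ℕ} → (∀ i → f i ≡ 0) → sum f ≡ 0
  sum-zero {n = n} f≗0 = trans (sum-cong-≗ f≗0) (trans (sum-const n 0) (*-zeroʳ n))

  -- A Kronecker delta. Read backwards it inserts a sum over all values, so that a count can be
  -- regrouped by value with `∑-comm`.
  sum-select : (i : Fin n) (f : Fin n → ℕ) → sum (λ j → 𝟙 (i ≟ᶠ j) * f j) ≡ f i
  sum-select zero    f = trans
    (cong₂ _+_ (+-identityʳ (f zero)) (sum-zero λ j → cong (_* f (suc j)) (𝟙-no (zero ≟ᶠ suc j) λ ())))
    (+-identityʳ (f zero))
  sum-select (suc i) f = trans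
    (sum-cong-≗ λ j → cong (_* f (suc j)) (𝟙-cong (suc i ≟ᶠ suc j) (i ≟ᶠ j) Fin.suc-injective (cong suc)))
    (sum-select i (f ∘ suc))

  sum-≟ : (i : Fin n) → sum (λ j → 𝟙 (i ≟ᶠ j)) ≡ 1
  sum-≟ i = trans (sum-cong-≗ λ j → sym (*-identityʳ (𝟙 (i ≟ᶠ j)))) (sum-select i (const 1))

  term≤sum : (f : Fin n → ℕ) (i : Fin n) → f i ≤ sum f
  term≤sum f zero    = m≤m+n _ _
  term≤sum f (suc i) = ≤-trans (term≤sum (f ∘ suc) i) (m≤n+m _ _)

  two-terms≤sum : (f : Fin n → ℕ) {i j : Fin n} → i ≢ j → f i + f j ≤ sum f
  two-terms≤sum f {zero}  {zero}  i≢j = contradiction refl i≢j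
  two-terms≤sum f {zero}  {suc j} i≢j = +-monoʳ-≤ (f zero) (term≤sum (f ∘ suc) j)
  two-terms≤sum f {suc i} {zero}  i≢j =
    ≤-trans (≤-reflexive (+-comm (f (suc i)) (f zero))) (+-monoʳ-≤ (f zero) (term≤sum (f ∘ suc) i))
  two-terms≤sum f {suc i} {suc j} i≢j =
    ≤-trans (two-terms≤sum (f ∘ suc) (i≢j ∘ cong suc)) (m≤n+m _ _)

  count : {P : Pred (Fin n) p} → Decidable P → ℕ
  count P? = sum (𝟙 ∘ P?)

  module _ {P : Pred (Fin n) p} (P? : Decidable P) where

    count≤ : count P? ≤ n
    count≤ = ≤-trans (sum-mono λ x → 𝟙≤1 (P? x)) (≤-reflexive (trans (sum-const n 1) (*-identityʳ n)))

    count-all : (∀ x → P x) → count P? ≡ n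
    count-all all = trans (sum-cong-≗ λ x → 𝟙-yes (P? x) (all x)) (trans (sum-const n 1) (*-identityʳ n))

    0<count : ∀ {x} → P x → 0 < count P?
    0<count {x} px = ≤-trans (≤-reflexive (sym (𝟙-yes (P? x) px))) (term≤sum (𝟙 ∘ P?) x)

    -- Double counting of the pairs `(j , x)` with `f j ≡ x`: every `j` lies in exactly one of them,
    -- every `x` in at most one, and in none unless `P x`.
    injection⇒≤count : (f : Fin m → Fin n) → Injective _≡_ _≡_ f → (∀ j → P (f j)) → m ≤ count P?
    injection⇒≤count {m} f inj pf = begin
      m                                        ≡⟨ trans (sum-const m 1) (*-identityʳ m) ⟨
      sum {m} (const 1)                        ≡⟨ sum-cong-≗ (λ j → sum-≟ (f j)) ⟨
      sum (λ j → sum (λ x → 𝟙 (f j ≟ᶠ x)))     ≡⟨ ∑-comm (λ j x → 𝟙 (f j ≟ᶠ x)) ⟩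
      sum (λ x → sum (λ j → 𝟙 (f j ≟ᶠ x)))     ≤⟨ sum-mono fibre ⟩
      count P?                                 ∎
      where
      open ≤-Reasoning
      fibre : ∀ x → sum (λ j → 𝟙 (f j ≟ᶠ x)) ≤ 𝟙 (P? x)
      fibre x with any? (λ j → f j ≟ᶠ x)
      ... | no ¬hit = ≤-trans (≤-reflexive (sum-zero λ j → 𝟙-no (f j ≟ᶠ x) (¬hit ∘ (j ,_)))) z≤n
      ... | yes (j , refl) = ≤-reflexive (begin-equality
        sum (λ k → 𝟙 (f k ≟ᶠ f j))  ≡⟨ sum-cong-≗ (λ k → 𝟙-cong (f k ≟ᶠ f j) (j ≟ᶠ k) (sym ∘ inj) (sym ∘ cong f)) ⟩
        sum (λ k → 𝟙 (j ≟ᶠ k))      ≡⟨ sum-≟ j ⟩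
        1                           ≡⟨ 𝟙-yes (P? (f j)) (pf j) ⟨
        𝟙 (P? (f j))                ∎)

    -- Pigeonhole: an `x` in `P` missed by `f` would extend it to an injection of `Fin (suc m)` into
    -- `P`.
    injection-fills : (f : Fin m → Fin n) → Injective _≡_ _≡_ f → (∀ j → P (f j)) →
                      count P? ≤ m → ∀ {x} → P x → ∃ λ j → f j ≡ x
    injection-fills {m} f inj pf count≤m {x} px with any? (λ j → f j ≟ᶠ x)
    ... | yes hit = hit
    ... | no ¬hit = contradiction (injection⇒≤count f⁺ inj⁺ pf⁺) (<⇒≱ (s≤s count≤m))
      where
      f⁺ : Fin (suc m) → Fin n
      f⁺ zero    = x
      f⁺ (suc j) = f j
      inj⁺ : Injective _≡_ _≡_ f⁺
      inj⁺ {zero}  {zero}  _  = refl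
      inj⁺ {zero}  {suc j} eq = contradiction (j , sym eq) ¬hit
      inj⁺ {suc i} {zero}  eq = contradiction (i , eq) ¬hit
      inj⁺ {suc i} {suc j} eq = cong suc (inj eq)
      pf⁺ : ∀ j → P (f⁺ j)
      pf⁺ zero    = px
      pf⁺ (suc j) = pf j

  module _ {P Q : Pred (Fin n) p} (P? : Decidable P) (Q? : Decidable Q) where

    count-mono : (∀ {x} → P x → Q x) → count P? ≤ count Q?
    count-mono P⊆Q = sum-mono λ x → 𝟙-mono (P? x) (Q? x) P⊆Q

    count-cong : (∀ {x} → P x → Q x) → (∀ {x} → Q x → P x) → count P? ≡ count Q?
    count-cong P⊆Q Q⊆P = sum-cong-≗ λ x → 𝟙-cong (P? x) (Q? x) P⊆Q Q⊆P

    count<⇒∃ : count P? < count Q? → ∃ λ x → Q x × ¬ P x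
    count<⇒∃ lt with any? (λ x → Q? x ×-dec ¬? (P? x))
    ... | yes hit = hit
    ... | no ¬hit = contradiction (sum-mono λ x → 𝟙-mono (Q? x) (P? x) (Q⊆P x)) (<⇒≱ lt)
      where
      Q⊆P : ∀ x → Q x → P x
      Q⊆P x qx with P? x
      ... | yes px = px
      ... | no ¬px = contradiction (x , qx , ¬px) ¬hit

open Counting

-- Finite abelian groups

module FinGroup {n : ℕ} {_∙_ : Op₂ (Fin n)} {ε : Fin n} {_⁻¹ : Op₁ (Fin n)}
  (isAbelianGroup : IsAbelianGroup _≡_ _∙_ ε _⁻¹) where

  private
    G : AbelianGroup 0ℓ 0ℓ
    G = record { isAbelianGroup = isAbelianGroup }

  infix 4 _≟_
  _≟_ = _≟ᶠ_ {n}

  open AbelianGroup G public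
    using (_-_; assoc; comm; identityˡ; identityʳ; inverseˡ; inverseʳ; commutativeMonoid)
  open Algebra.Properties.AbelianGroup G public
    using (∙-cancelˡ; ∙-cancelʳ; ⁻¹-involutive; ⁻¹-anti-homo‿-; ε⁻¹≈ε; inverseˡ-unique)
  open Algebra.Properties.CommutativeMonoid.Mult commutativeMonoid public
    using (×-homo-1; ×-homo-+; ×-assocˡ; ×-distrib-+)
    renaming (_×_ to _·_)
  private
    module ∑ = Algebra.Properties.CommutativeMonoid.Sum commutativeMonoid

  translation : Fin n → Permutation′ n
  translation x = permutation (x ∙_) ((x ⁻¹) ∙_) (cancel (inverseʳ x)) (cancel (inverseˡ x))
    where
    cancel : ∀ {x y} → x ∙ y ≡ ε → ∀ z → x ∙ (y ∙ z) ≡ z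
    cancel {x} {y} xy≡ε z = trans (sym (assoc x y z)) (trans (cong (_∙ z) xy≡ε) (identityˡ z))

  negation : Permutation′ n
  negation = permutation _⁻¹ _⁻¹ ⁻¹-involutive ⁻¹-involutive

  -- Translation by x permutes the group, so the sum of all elements is unchanged by adding n · x.
  order· : ∀ x → n · x ≡ ε
  order· x = ∙-cancelʳ (∑.sum id) (n · x) ε (begin
    (n · x) ∙ ∑.sum id                 ≡⟨ cong (_∙ ∑.sum id) (∑.sum-replicate n) ⟨
    (∑.sum {n} (const x)) ∙ ∑.sum id   ≡⟨ ∑.∑-distrib-+ (const x) id ⟨
    ∑.sum (x ∙_)                       ≡⟨ ∑.sum-permute id (translation x) ⟨
    ∑.sum id                           ≡⟨ identityˡ _ ⟨
    ε ∙ ∑.sum id                       ∎)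
    where open ≡-Reasoning

  ·ε : ∀ m → m · ε ≡ ε
  ·ε zero    = refl
  ·ε (suc m) = trans (identityˡ _) (·ε m)

  ·-⁻¹ : ∀ m x → m · (x ⁻¹) ≡ (m · x) ⁻¹
  ·-⁻¹ m x = inverseˡ-unique _ _ (begin
    (m · (x ⁻¹)) ∙ (m · x)  ≡⟨ ×-distrib-+ (x ⁻¹) x m ⟨
    m · ((x ⁻¹) ∙ x)        ≡⟨ cong (m ·_) (inverseˡ x) ⟩
    m · ε                   ≡⟨ ·ε m ⟩
    ε                       ∎)
    where open ≡-Reasoning

  ·-swap : ∀ a b x → a · (b · x) ≡ b · (a · x)
  ·-swap a b x = trans (×-assocˡ x a b) (trans (cong (_· x) (*-comm a b)) (sym (×-assocˡ x b a)))

  ·-ε-∣ : ∀ a b {x} → a ∣ b → a · x ≡ ε → b · x ≡ ε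
  ·-ε-∣ a _ {x} (divides k refl) ax≡ε = trans (sym (×-assocˡ x k a)) (trans (cong (k ·_) ax≡ε) (·ε k))

  ··-ε-∣ : ∀ a b c {x} → a ∣ b * c → a · x ≡ ε → b · (c · x) ≡ ε
  ··-ε-∣ a b c {x} a∣bc ax≡ε = trans (×-assocˡ x b c) (·-ε-∣ a (b * c) a∣bc ax≡ε)

  ··-ε⇒*-ε : ∀ a b {c x} → a * b ≡ c → a · (b · x) ≡ ε → c · x ≡ ε
  ··-ε⇒*-ε a b {x = x} refl eq = trans (sym (×-assocˡ x a b)) eq

  ·-∙-εˡ : ∀ m x y → m · x ≡ ε → m · (x ∙ y) ≡ m · y
  ·-∙-εˡ m x y mx≡ε = trans (×-distrib-+ x y m) (trans (cong (_∙ (m · y)) mx≡ε) (identityˡ _))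

  ·-∙-εʳ : ∀ m x y → m · y ≡ ε → m · (x ∙ y) ≡ m · x
  ·-∙-εʳ m x y my≡ε = trans (×-distrib-+ x y m) (trans (cong ((m · x) ∙_) my≡ε) (identityʳ _))

  -- Takes Bézout's identity in its subtraction-free form over ℕ; `·-ε-gcd` needs it for either sign
  -- of the coefficients.
  ·-ε-combination : ∀ {d x} a b k l → a · x ≡ ε → b · x ≡ ε → d + l * b ≡ k * a → d · x ≡ ε
  ·-ε-combination {d} {x} a b k l ax≡ε bx≡ε eq = begin
    d · x                    ≡⟨ identityʳ _ ⟨
    (d · x) ∙ ε              ≡⟨ cong ((d · x) ∙_) (·-ε-∣ b (l * b) (divides l refl) bx≡ε) ⟨
    (d · x) ∙ ((l * b) · x)  ≡⟨ ×-homo-+ x d (l * b) ⟨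
    (d + l * b) · x          ≡⟨ cong (_· x) eq ⟩
    (k * a) · x              ≡⟨ ·-ε-∣ a (k * a) (divides k refl) ax≡ε ⟩
    ε                        ∎
    where open ≡-Reasoning

  ·-ε-gcd : ∀ a b {d x} → gcd a b ≡ d → a · x ≡ ε → b · x ≡ ε → d · x ≡ ε
  ·-ε-gcd a b {d} {x} refl ax≡ε bx≡ε with Bézout.identity (gcd-GCD a b)
  ... | Bézout.+- k l eq = ·-ε-combination a b k l ax≡ε bx≡ε eq
  ... | Bézout.-+ k l eq = ·-ε-combination b a l k bx≡ε ax≡ε eq

  HasOrder : Fin n → ℕ → Set
  HasOrder x q = q · x ≡ ε × (∀ k → 0 < k → k < q → k · x ≢ ε)

  -- ds stands for the maximal proper divisors of q: the order of x divides q, so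
  -- if it is a proper divisor then it divides one of them.
  hasOrder : ∀ {q x} (ds : List ℕ) → (∀ {g} → g < q → g ∣ q → Any (g ∣_) ds) →
             q · x ≡ ε → All (λ d → d · x ≢ ε) ds → HasOrder x q
  hasOrder {q} {x} ds maximal qx≡ε dx≢ε = qx≡ε , λ k 0<k k<q kx≡ε →
    let g<q        = ≤-<-trans (∣⇒≤ {{>-nonZero 0<k}} (gcd[m,n]∣m k q)) k<q
        gx≡ε       = ·-ε-gcd k q refl kx≡ε qx≡ε
        ne , g∣d   = lookupAny dx≢ε (maximal g<q (gcd[m,n]∣n k q))
    in ne (·-ε-∣ (gcd k q) _ g∣d gx≡ε)

  ∸-· : ∀ {i j x} → i ≤ j → i · x ≡ j · x → (j ∸ i) · x ≡ ε
  ∸-· {i} {j} {x} i≤j eq = ∙-cancelʳ (i · x) _ _ (begin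
    ((j ∸ i) · x) ∙ (i · x)  ≡⟨ ×-homo-+ x (j ∸ i) i ⟨
    (j ∸ i + i) · x          ≡⟨ cong (_· x) (m∸n+n≡m i≤j) ⟩
    j · x                    ≡⟨ eq ⟨
    i · x                    ≡⟨ identityˡ _ ⟨
    ε ∙ (i · x)              ∎)
    where open ≡-Reasoning

  multiples-injective : ∀ {q x} → HasOrder x q → ∀ {i j} → i < q → j < q → i · x ≡ j · x → i ≡ j
  multiples-injective (_ , nz) {i} {j} i<q j<q eq with <-cmp i j
  ... | tri≈ _ i≡j _ = i≡j
  ... | tri< i<j _ _ = contradiction (∸-· (<⇒≤ i<j) eq)       (nz (j ∸ i) (m<n⇒0<n∸m i<j) (≤-<-trans (m∸n≤m j i) j<q))
  ... | tri> _ _ j<i = contradiction (∸-· (<⇒≤ j<i) (sym eq)) (nz (i ∸ j) (m<n⇒0<n∸m j<i) (≤-<-trans (m∸n≤m i j) i<q))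

  kernel : ℕ → ℕ
  kernel m = count (λ x → m · x ≟ ε)

  Image : ℕ → Fin n → Set
  Image m y = ∃ λ x → m · x ≡ y

  image? : ∀ m → Decidable (Image m)
  image? m y = any? λ x → m · x ≟ y

  -- A nonempty fibre is a coset of the kernel: translation by `x₀` is a bijection between the two.
  fibre≡kernel : ∀ m {y} → Image m y → count (λ x → m · x ≟ y) ≡ kernel m
  fibre≡kernel m (x₀ , refl) = begin
    sum (λ x → 𝟙 (m · x ≟ m · x₀))         ≡⟨ sum-permute (λ x → 𝟙 (m · x ≟ m · x₀)) (translation x₀) ⟩
    sum (λ x → 𝟙 (m · (x₀ ∙ x) ≟ m · x₀))  ≡⟨ count-cong (λ x → m · (x₀ ∙ x) ≟ m · x₀) (λ x → m · x ≟ ε)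
                                                (λ {x} eq → ∙-cancelˡ _ _ _ (trans (sym (×-distrib-+ x₀ x m)) (trans eq (sym (identityʳ _)))))
                                                (λ {x} eq → trans (×-distrib-+ x₀ x m) (trans (cong ((m · x₀) ∙_) eq) (identityʳ _))) ⟩
    kernel m                               ∎
    where open ≡-Reasoning

  -- Group the `x` by `y = m · x`: a `y` in the image arises from `kernel m` values of `x`, any
  -- other from none.
  count-∘· : ∀ m {Q : Pred (Fin n) 0ℓ} (Q? : Decidable Q) →
             count (λ x → Q? (m · x)) ≡ kernel m * count (λ y → Q? y ×-dec image? m y)
  count-∘· m Q? = begin
    sum (λ x → 𝟙 (Q? (m · x)))                          ≡⟨ sum-cong-≗ (λ x → sum-select (m · x) (𝟙 ∘ Q?)) ⟨
    sum (λ x → sum (λ y → 𝟙 (m · x ≟ y) * 𝟙 (Q? y)))    ≡⟨ ∑-comm (λ x y → 𝟙 (m · x ≟ y) * 𝟙 (Q? y)) ⟩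
    sum (λ y → sum (λ x → 𝟙 (m · x ≟ y) * 𝟙 (Q? y)))    ≡⟨ sum-cong-≗ (λ y → *-distribʳ-sum (𝟙 (Q? y)) (λ x → 𝟙 (m · x ≟ y))) ⟨
    sum (λ y → count (λ x → m · x ≟ y) * 𝟙 (Q? y))      ≡⟨ sum-cong-≗ fibre ⟩
    sum (λ y → kernel m * 𝟙 (Q? y ×-dec image? m y))    ≡⟨ *-distribˡ-sum (kernel m) (λ y → 𝟙 (Q? y ×-dec image? m y)) ⟨
    kernel m * count (λ y → Q? y ×-dec image? m y)      ∎
    where
    open ≡-Reasoning
    fibre : ∀ y → count (λ x → m · x ≟ y) * 𝟙 (Q? y) ≡ kernel m * 𝟙 (Q? y ×-dec image? m y)
    fibre y with image? m y in eq
    ... | yes im = cong₂ _*_ (fibre≡kernel m im) (𝟙-cong (Q? y) (Q? y ×-dec yes im) (_, im) proj₁)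
    ... | no ¬im = trans
      (cong (_* 𝟙 (Q? y)) (sum-zero λ x → 𝟙-no (m · x ≟ y) (λ mx≡y → ¬im (x , mx≡y))))
      (sym (trans (cong (kernel m *_) (𝟙-no (Q? y ×-dec no ¬im) (¬im ∘ proj₂))) (*-zeroʳ (kernel m))))

  -- The first isomorphism theorem in cardinalities: `count-∘·` for the predicate `Image m`, which
  -- holds at every `m · x`.
  kernel*image : ∀ m → n ≡ kernel m * count (image? m)
  kernel*image m = begin
    n                                                     ≡⟨ count-all (λ x → m · x ≟ m · x) (λ _ → refl) ⟨
    count (λ x → m · x ≟ m · x)                           ≡⟨ count-cong (λ x → m · x ≟ m · x) (λ x → image? m (m · x)) (λ {x} _ → x , refl) (λ _ → refl) ⟩
    count (λ x → image? m (m · x))                        ≡⟨ count-∘· m (image? m) ⟩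
    kernel m * count (λ y → image? m y ×-dec image? m y)  ≡⟨ cong (kernel m *_) (count-cong (λ y → image? m y ×-dec image? m y) (image? m) proj₁ λ im → im , im) ⟩
    kernel m * count (image? m)                           ∎
    where open ≡-Reasoning

  -- Multiplication by `b` maps the solutions of `(a * b) · x ≡ ε` onto the `y` counted on the
  -- right, with fibres of size `kernel b`. This relates the solutions of 4x = 0 and 8x = 0 to those
  -- of 2x = 0.
  kernel-* : ∀ a b → kernel (a * b) ≡ kernel b * count (λ y → (a · y ≟ ε) ×-dec image? b y)
  kernel-* a b = trans
    (count-cong (λ x → (a * b) · x ≟ ε) (λ x → a · (b · x) ≟ ε) (λ {x} → trans (×-assocˡ x a b)) (λ {x} → trans (sym (×-assocˡ x a b))))
    (count-∘· b (λ y → a · y ≟ ε))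

  module _ {P : Pred (Fin n) 0ℓ} (P? : Decidable P) (symmetric : ∀ {x} → P x → P (x ⁻¹)) where

    -- The elements that are not their own inverse form pairs; the order of `Fin n` singles out the
    -- smaller member of each, and `below` counts these.
    count-symmetric : ∃ λ k → count P? ≡ count (λ x → P? x ×-dec (x ⁻¹ ≟ x)) + 2 * k
    count-symmetric = below , (begin
      count P?                                     ≡⟨ sum-cong-≗ split ⟩
      sum (λ x → fixed x + (lt x + gt x))          ≡⟨ ∑-distrib-+ fixed (λ x → lt x + gt x) ⟩
      sum fixed + sum (λ x → lt x + gt x)          ≡⟨ cong (sum fixed +_) (∑-distrib-+ lt gt) ⟩
      sum fixed + (below + sum gt)                 ≡⟨ cong (λ s → sum fixed + (below + s)) above ⟩
      sum fixed + (below + below)                  ≡⟨ cong (λ s → sum fixed + (below + s)) (+-identityʳ below) ⟨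
      sum fixed + 2 * below                        ∎)
      where
      open ≡-Reasoning
      lt? = λ x → P? x ×-dec (x Fin.<? x ⁻¹)
      gt? = λ x → P? x ×-dec (x ⁻¹ Fin.<? x)
      lt = 𝟙 ∘ lt?
      gt = 𝟙 ∘ gt?
      fixed = λ x → 𝟙 (P? x ×-dec (x ⁻¹ ≟ x))
      below = sum lt
      above : sum gt ≡ below
      above = trans (sum-permute gt negation) (count-cong (λ x → gt? (x ⁻¹)) lt?
        (λ {x} (p , l) → subst P (⁻¹-involutive x) (symmetric p) , subst (Fin._< (x ⁻¹)) (⁻¹-involutive x) l)
        (λ {x} (p , l) → symmetric p , subst (Fin._< (x ⁻¹)) (sym (⁻¹-involutive x)) l))
      split : ∀ x → 𝟙 (P? x) ≡ fixed x + (lt x + gt x)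
      split x with Fin.<-cmp x (x ⁻¹) | P? x
      ... | _            | no _ = refl
      ... | tri< l ≢ ≯ | yes p = sym (cong₂ _+_ (𝟙-no (x ⁻¹ ≟ x) (≢ ∘ sym)) (cong₂ _+_ (𝟙-yes (x Fin.<? x ⁻¹) l) (𝟙-no (x ⁻¹ Fin.<? x) ≯)))
      ... | tri≈ ≮ e ≯ | yes p = sym (cong₂ _+_ (𝟙-yes (x ⁻¹ ≟ x) (sym e)) (cong₂ _+_ (𝟙-no (x Fin.<? x ⁻¹) ≮) (𝟙-no (x ⁻¹ Fin.<? x) ≯)))
      ... | tri> ≮ ≢ g | yes p = sym (cong₂ _+_ (𝟙-no (x ⁻¹ ≟ x) (≢ ∘ sym)) (cong₂ _+_ (𝟙-no (x Fin.<? x ⁻¹) ≮) (𝟙-yes (x ⁻¹ Fin.<? x) g)))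

-- Differences of a covering set

-- If `a r` elements of S lie over the residue `r`, this is the number of ordered pairs in S whose
-- residues differ by `e`.
autocorrelation : ∀ {q} .{{_ : NonZero q}} → (Fin q → ℕ) → ℕ → ℕ
autocorrelation {q} a e = sum λ r → a r * a ((toℕ r + e) mod q)

module _ {n : ℕ} {_∙_ : Op₂ (Fin n)} {ε : Fin n} {_⁻¹ : Op₁ (Fin n)}
  (isAbelianGroup : IsAbelianGroup _≡_ _∙_ ε _⁻¹) where

  open FinGroup isAbelianGroup

  2·≡ε⇒⁻¹≡ : ∀ {x} → 2 · x ≡ ε → x ⁻¹ ≡ x
  2·≡ε⇒⁻¹≡ {x} eq = sym (inverseˡ-unique x x (trans (cong (x ∙_) (sym (identityʳ x))) eq))

  ⁻¹≡⇒2·≡ε : ∀ {x} → x ⁻¹ ≡ x → 2 · x ≡ ε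
  ⁻¹≡⇒2·≡ε {x} eq = trans (cong (x ∙_) (identityʳ x)) (trans (cong (x ∙_) (sym eq)) (inverseʳ x))

  module Covering {k : ℕ} (s : Fin (2 + k) → Fin n) (covers : ∀ g → ∃₂ λ i j → g ≡ s i - s j) where

    -- A lower bound for the number of representations of g as a difference:
    -- ε is s i - s i for each i, and if g = s i - s j is an involution then
    -- g = s j - s i too.
    weight : Fin n → ℕ
    weight g = 𝟙 (2 · g ≟ ε) + (1 + k * 𝟙 (g ≟ ε))

    weight≤representations : ∀ g → weight g ≤ sum λ i → sum λ j → 𝟙 (s i - s j ≟ g)
    weight≤representations g with g ≟ ε
    ... | yes refl = begin
      𝟙 (2 · ε ≟ ε) + (1 + k * 1)            ≡⟨ cong₂ _+_ (𝟙-yes (2 · ε ≟ ε) (·ε 2)) (cong suc (*-identityʳ k)) ⟩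
      2 + k                                  ≡⟨ trans (sum-const (2 + k) 1) (*-identityʳ (2 + k)) ⟨
      sum {2 + k} (const 1)                  ≤⟨ sum-mono (λ i → ≤-trans
                                                  (≤-reflexive (sym (𝟙-yes (s i - s i ≟ ε) (inverseʳ (s i)))))
                                                  (term≤sum (λ j → 𝟙 (s i - s j ≟ ε)) i)) ⟩
      sum (λ i → sum λ j → 𝟙 (s i - s j ≟ ε))  ∎
      where open ≤-Reasoning
    ... | no g≢ε with covers g
    ...   | i , j , refl = begin
      𝟙 (2 · (s i - s j) ≟ ε) + (1 + k * 0)  ≡⟨ cong (λ z → 𝟙 (2 · (s i - s j) ≟ ε) + suc z) (*-zeroʳ k) ⟩
      𝟙 (2 · (s i - s j) ≟ ε) + 1            ≤⟨ +-mono-≤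
                                                  (≤-trans
                                                    (𝟙-mono (2 · (s i - s j) ≟ ε) (s j - s i ≟ s i - s j)
                                                      (λ eq → trans (sym (⁻¹-anti-homo‿- (s i) (s j))) (2·≡ε⇒⁻¹≡ eq)))
                                                    (term≤sum (λ l → 𝟙 (s j - s l ≟ s i - s j)) i))
                                                  (≤-trans
                                                    (≤-reflexive (sym (𝟙-yes (s i - s j ≟ s i - s j) refl)))
                                                    (term≤sum (λ l → 𝟙 (s i - s l ≟ s i - s j)) j)) ⟩
      -- The representations `s i - s j` and `s j - s i` stand in different rows, because `g ≢ ε`
      -- forces `i ≢ j`.
      row j + row i                          ≤⟨ two-terms≤sum row j≢i ⟩
      sum row                                ∎
      where
      open ≤-Reasoning
      row : Fin (2 + k) → ℕ
      row l = sum λ l′ → 𝟙 (s l - s l′ ≟ s i - s j)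
      j≢i : j ≢ i
      j≢i refl = g≢ε (inverseʳ (s i))

    module _ {P : Pred (Fin n) 0ℓ} (P? : Decidable P) where

      -- After interchanging the sums of `weight≤representations`, each pair `i`, `j` is counted at
      -- the single element `g = s i - s j`.
      weight≤differences : sum (λ g → 𝟙 (P? g) * weight g) ≤ sum λ i → count λ j → P? (s i - s j)
      weight≤differences = begin
        sum (λ g → 𝟙 (P? g) * weight g)
          ≤⟨ sum-mono (λ g → *-monoʳ-≤ (𝟙 (P? g)) (weight≤representations g)) ⟩
        sum (λ g → 𝟙 (P? g) * sum (λ i → sum λ j → 𝟙 (s i - s j ≟ g)))
          ≡⟨ sum-cong-≗ (λ g → trans (*-comm (𝟙 (P? g)) (sum λ i → sum λ j → 𝟙 (s i - s j ≟ g)))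
               (trans (*-distribʳ-sum (𝟙 (P? g)) (λ i → sum λ j → 𝟙 (s i - s j ≟ g)))
                 (sum-cong-≗ λ i → *-distribʳ-sum (𝟙 (P? g)) (λ j → 𝟙 (s i - s j ≟ g))))) ⟩
        sum (λ g → sum λ i → sum λ j → 𝟙 (s i - s j ≟ g) * 𝟙 (P? g))
          ≡⟨ ∑-comm (λ g i → sum λ j → 𝟙 (s i - s j ≟ g) * 𝟙 (P? g)) ⟩
        sum (λ i → sum λ g → sum λ j → 𝟙 (s i - s j ≟ g) * 𝟙 (P? g))
          ≡⟨ sum-cong-≗ (λ i → trans (∑-comm (λ g j → 𝟙 (s i - s j ≟ g) * 𝟙 (P? g)))
               (sum-cong-≗ λ j → sum-select (s i - s j) (𝟙 ∘ P?))) ⟩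
        sum (λ i → count λ j → P? (s i - s j))
          ∎
        where open ≤-Reasoning

      sum-weight : sum (λ g → 𝟙 (P? g) * weight g) ≡
                   count (λ g → P? g ×-dec (2 · g ≟ ε)) + (count P? + k * count (λ g → P? g ×-dec (g ≟ ε)))
      sum-weight = begin
        sum (λ g → 𝟙 (P? g) * weight g)
          ≡⟨ sum-cong-≗ (λ g → begin
               𝟙 (P? g) * weight g
                 ≡⟨ *-distribˡ-+ (𝟙 (P? g)) (𝟙 (2 · g ≟ ε)) _ ⟩
               𝟙 (P? g) * 𝟙 (2 · g ≟ ε) + 𝟙 (P? g) * (1 + k * 𝟙 (g ≟ ε))
                 ≡⟨ cong₂ _+_ (sym (𝟙-× (P? g) (2 · g ≟ ε))) (trans (*-suc (𝟙 (P? g)) (k * 𝟙 (g ≟ ε))) (cong (𝟙 (P? g) +_)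
                      (trans (x∙yz≈y∙xz (𝟙 (P? g)) k (𝟙 (g ≟ ε))) (cong (k *_) (sym (𝟙-× (P? g) (g ≟ ε))))))) ⟩
               torsion g + (𝟙 (P? g) + k * zeros g)
                 ∎) ⟩
        sum (λ g → torsion g + (𝟙 (P? g) + k * zeros g))
          ≡⟨ ∑-distrib-+ torsion (λ g → 𝟙 (P? g) + k * zeros g) ⟩
        sum torsion + sum (λ g → 𝟙 (P? g) + k * zeros g)
          ≡⟨ cong (sum torsion +_) (∑-distrib-+ (𝟙 ∘ P?) (λ g → k * zeros g)) ⟩
        sum torsion + (count P? + sum (λ g → k * zeros g))
          ≡⟨ cong (λ z → sum torsion + (count P? + z)) (*-distribˡ-sum k zeros) ⟨
        sum torsion + (count P? + k * sum zeros)
          ∎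
        where
        open ≡-Reasoning
        open import Algebra.Properties.CommutativeSemigroup *-commutativeSemigroup using (x∙yz≈y∙xz)
        torsion zeros : Fin n → ℕ
        torsion g = 𝟙 (P? g ×-dec (2 · g ≟ ε))
        zeros g   = 𝟙 (P? g ×-dec (g ≟ ε))

    1≤zeros : {P : Pred (Fin n) 0ℓ} (P? : Decidable P) → P ε → 1 ≤ count (λ g → P? g ×-dec (g ≟ ε))
    1≤zeros P? pε = 0<count (λ g → P? g ×-dec (g ≟ ε)) (pε , refl)

    -- The predicate `g ≟ g` holds everywhere, so all differences are counted. For `k = 5` this is
    -- the inequality n + N + 5 ≤ 49.
    order-bound : kernel 2 + (n + k) ≤ (2 + k) * (2 + k)
    order-bound = begin
      kernel 2 + (n + k)
        ≤⟨ +-mono-≤ (≤-reflexive (count-cong (λ g → 2 · g ≟ ε) (λ g → all? g ×-dec (2 · g ≟ ε)) (refl ,_) proj₂))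
             (+-mono-≤ (≤-reflexive (sym (count-all all? λ _ → refl)))
               (≤-trans (≤-reflexive (sym (*-identityʳ k))) (*-monoʳ-≤ k (1≤zeros all? refl)))) ⟩
      count (λ g → all? g ×-dec (2 · g ≟ ε)) + (count all? + k * count (λ g → all? g ×-dec (g ≟ ε)))
        ≡⟨ sum-weight all? ⟨
      sum (λ g → 𝟙 (all? g) * weight g)
        ≤⟨ weight≤differences all? ⟩
      sum (λ i → count λ j → all? (s i - s j))
        ≤⟨ sum-mono (λ i → count≤ (λ j → all? (s i - s j))) ⟩
      sum {2 + k} (const (2 + k))
        ≡⟨ sum-const (2 + k) (2 + k) ⟩
      (2 + k) * (2 + k)
        ∎
      where
      open ≤-Reasoning
      all? = λ (g : Fin n) → g ≟ g

    -- The homomorphism m · x = r · κ ↦ r onto ℤ/q.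
    module Residues (m q : ℕ) .{{_ : NonZero q}} {κ : Fin n} (κ-image : Image m κ)
                    (κ-order : HasOrder κ q) (image≤q : count (image? m) ≤ q) where

      private
        multiple : Fin q → Fin n
        multiple r = toℕ r · κ

        multiple-image : ∀ r → Image m (multiple r)
        multiple-image r = toℕ r · proj₁ κ-image ,
          trans (·-swap m (toℕ r) (proj₁ κ-image)) (cong (toℕ r ·_) (proj₂ κ-image))

        multiple-injective : Injective _≡_ _≡_ multiple
        multiple-injective {i} {j} eq = toℕ-injective (multiples-injective κ-order (toℕ<n i) (toℕ<n j) eq)

        abstract
          -- The `q` multiples of `κ` are distinct and lie in the image of `m`, which has at most
          -- `q` elements, so they exhaust it.
          logarithm : ∀ x → ∃ λ r → multiple r ≡ m · x
          logarithm x = injection-fills (image? m) multiple multiple-injective multiple-image image≤q (x , refl)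

      kernel*q : n ≡ kernel m * q
      kernel*q = trans (kernel*image m) (cong (kernel m *_)
        (≤-antisym image≤q (injection⇒≤count (image? m) multiple multiple-injective multiple-image)))

      residue : Fin n → Fin q
      residue = proj₁ ∘ logarithm

      ·-% : ∀ a → a · κ ≡ (a % q) · κ
      ·-% a = begin
        a · κ                            ≡⟨ cong (_· κ) (m≡m%n+[m/n]*n a q) ⟩
        (a % q + a / q * q) · κ          ≡⟨ ×-homo-+ κ (a % q) (a / q * q) ⟩
        ((a % q) · κ) ∙ ((a / q * q) · κ)  ≡⟨ cong (((a % q) · κ) ∙_) (·-ε-∣ q (a / q * q) (divides (a / q) refl) (proj₁ κ-order)) ⟩
        ((a % q) · κ) ∙ ε                ≡⟨ identityʳ _ ⟩
        (a % q) · κ                      ∎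
        where open ≡-Reasoning

      residue-unique : ∀ {x} a → m · x ≡ a · κ → residue x ≡ a mod q
      residue-unique {x} a eq = toℕ-injective (trans
        (multiples-injective κ-order (toℕ<n (residue x)) (m%n<n a q)
          (trans (proj₂ (logarithm x)) (trans eq (·-% a))))
        (sym (toℕ-fromℕ< (m%n<n a q))))

      residue-- : ∀ {x y} e → m · (x - y) ≡ e · κ → residue x ≡ (toℕ (residue y) + e) mod q
      residue-- {x} {y} e eq = residue-unique _ (begin
        m · x                          ≡⟨ cong (m ·_) (x≡[x-y]y) ⟩
        m · ((x - y) ∙ y)              ≡⟨ ×-distrib-+ (x - y) y m ⟩
        (m · (x - y)) ∙ (m · y)        ≡⟨ cong₂ _∙_ eq (sym (proj₂ (logarithm y))) ⟩
        (e · κ) ∙ (toℕ (residue y) · κ)  ≡⟨ comm _ _ ⟩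
        (toℕ (residue y) · κ) ∙ (e · κ)  ≡⟨ ×-homo-+ κ (toℕ (residue y)) e ⟨
        (toℕ (residue y) + e) · κ      ∎)
        where
        open ≡-Reasoning
        x≡[x-y]y : x ≡ (x - y) ∙ y
        x≡[x-y]y = sym (trans (assoc x (y ⁻¹) y) (trans (cong (x ∙_) (inverseˡ y)) (identityʳ x)))

      occurrences : Fin q → ℕ
      occurrences r = count λ i → residue (s i) Fin.≟ r

      sum-occurrences : sum occurrences ≡ 2 + k
      sum-occurrences = begin
        sum occurrences                                      ≡⟨ ∑-comm (λ r i → 𝟙 (residue (s i) Fin.≟ r)) ⟩
        sum (λ i → sum λ r → 𝟙 (residue (s i) Fin.≟ r))      ≡⟨ sum-cong-≗ (λ i → sum-≟ (residue (s i))) ⟩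
        sum {2 + k} (const 1)                                ≡⟨ sum-const (2 + k) 1 ⟩
        (2 + k) * 1                                          ≡⟨ *-identityʳ (2 + k) ⟩
        2 + k                                                ∎
        where open ≡-Reasoning

      -- If `m · (s i - s j)` is `e · κ`, the residue of `s i` is that of `s j` shifted by `e`;
      -- grouping the `j` by residue gives the autocorrelation.
      weight≤autocorrelation : ∀ e → sum (λ g → 𝟙 (m · g ≟ e · κ) * weight g) ≤
                               autocorrelation occurrences e
      weight≤autocorrelation e = begin
        sum (λ g → 𝟙 (m · g ≟ e · κ) * weight g)
          ≤⟨ weight≤differences (λ g → m · g ≟ e · κ) ⟩
        sum (λ i → count λ j → m · (s i - s j) ≟ e · κ)
          ≤⟨ sum-mono (λ i → count-mono (λ j → m · (s i - s j) ≟ e · κ) (λ j → ρ i Fin.≟ shift (ρ j)) (residue-- e)) ⟩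
        sum (λ i → count λ j → ρ i Fin.≟ shift (ρ j))
          ≡⟨ ∑-comm (λ i j → 𝟙 (ρ i Fin.≟ shift (ρ j))) ⟩
        sum (λ j → occurrences (shift (ρ j)))
          ≡⟨ sum-cong-≗ (λ j → sum-select (ρ j) (occurrences ∘ shift)) ⟨
        sum (λ j → sum λ r → 𝟙 (ρ j Fin.≟ r) * occurrences (shift r))
          ≡⟨ ∑-comm (λ j r → 𝟙 (ρ j Fin.≟ r) * occurrences (shift r)) ⟩
        sum (λ r → sum λ j → 𝟙 (ρ j Fin.≟ r) * occurrences (shift r))
          ≡⟨ sum-cong-≗ (λ r → *-distribʳ-sum (occurrences (shift r)) (λ j → 𝟙 (ρ j Fin.≟ r))) ⟨
        sum (λ r → occurrences r * occurrences (shift r))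
          ∎
        where
        open ≤-Reasoning
        ρ : Fin (2 + k) → Fin q
        ρ = residue ∘ s
        shift : Fin q → Fin q
        shift r = (toℕ r + e) mod q

      -- The fibre over `e · κ` has `kernel m` elements, each of weight at least 1.
      kernel≤autocorrelation : ∀ e → kernel m ≤ autocorrelation occurrences e
      kernel≤autocorrelation e = begin
        kernel m          ≡⟨ fibre≡kernel m (e · proj₁ κ-image , trans (·-swap m e _) (cong (e ·_) (proj₂ κ-image))) ⟨
        count eκ?         ≤⟨ m≤m+n (count eκ?) (k * zeros) ⟩
        count eκ? + k * zeros                        ≤⟨ m≤n+m (count eκ? + k * zeros) torsion ⟩
        torsion + (count eκ? + k * zeros)            ≡⟨ sum-weight eκ? ⟨
        sum (λ g → 𝟙 (eκ? g) * weight g)             ≤⟨ weight≤autocorrelation e ⟩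
        autocorrelation occurrences e  ∎
        where
        open ≤-Reasoning
        eκ? : Decidable (λ g → m · g ≡ e · κ)
        eκ? g = m · g ≟ e · κ
        torsion zeros : ℕ
        torsion = count (λ g → eκ? g ×-dec (2 · g ≟ ε))
        zeros   = count (λ g → eκ? g ×-dec (g ≟ ε))

      -- For `e = 0` the fibre is the kernel of `m`. It contains the identity, whose weight has the
      -- extra `k`, and solutions of 2g = 0, whose weight has an extra 1.
      kernel≤autocorrelation₀ : count (λ g → (m · g ≟ ε) ×-dec (2 · g ≟ ε)) + (kernel m + k) ≤
                                autocorrelation occurrences 0
      kernel≤autocorrelation₀ = begin
        torsion + (kernel m + k)                     ≡⟨ cong (λ z → torsion + (kernel m + z)) (*-identityʳ k) ⟨
        torsion + (kernel m + k * 1)                 ≤⟨ +-monoʳ-≤ torsion (+-monoʳ-≤ (kernel m) (*-monoʳ-≤ k (1≤zeros ker? (·ε m)))) ⟩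
        torsion + (kernel m + k * zeros)             ≡⟨ sum-weight ker? ⟨
        sum (λ g → 𝟙 (ker? g) * weight g)            ≤⟨ weight≤autocorrelation 0 ⟩
        autocorrelation occurrences 0  ∎
        where
        open ≤-Reasoning
        ker? : Decidable (λ g → m · g ≡ ε)
        ker? g = m · g ≟ ε
        torsion zeros : ℕ
        torsion = count (λ g → ker? g ×-dec (2 · g ≟ ε))
        zeros   = count (λ g → ker? g ×-dec (g ≟ ε))

-- Covering sets of ℤ/n by exhaustive search

module _ {a} {A : Set a} where

  ⊆-delete : ∀ {x} {xs ys zs : List A} → xs ⊆ ys ++ x ∷ zs → All (x ≢_) xs → xs ⊆ ys ++ zs
  ⊆-delete {x} {ys = ys} xs⊆ x∉ v∈xs with ∈-++⁻ ys (xs⊆ v∈xs)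
  ... | inj₁ v∈ys         = ∈-++⁺ˡ v∈ys
  ... | inj₂ (here v≡x)   = contradiction (sym v≡x) (All.lookup x∉ v∈xs)
  ... | inj₂ (there v∈zs) = ∈-++⁺ʳ ys v∈zs

  unique⊆⇒length≤ : ∀ {xs ys : List A} → Unique xs → xs ⊆ ys → length xs ≤ length ys
  unique⊆⇒length≤ []            _     = z≤n
  unique⊆⇒length≤ (x∉ ∷ unique) xs⊆ys with ∈-∃++ (xs⊆ys (here refl))
  ... | as , bs , refl = ≤-trans
    (s≤s (unique⊆⇒length≤ unique (⊆-delete (xs⊆ys ∘ there) x∉)))
    (≤-reflexive (trans (cong suc (length-++ as)) (trans (sym (+-suc (length as) (length bs))) (sym (length-++ as)))))

-- Takes equal values exactly at the pairs with the same difference up to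
-- sign modulo n, since d (n - d) determines {d , n - d}.
differenceClass : ℕ → ℕ → ℕ → ℕ
differenceClass n x y = d * (n ∸ d)
  where d = (x ∸ y) + (y ∸ x)

differenceClass-comm : ∀ n x y → differenceClass n x y ≡ differenceClass n y x
differenceClass-comm n x y = cong (λ d → d * (n ∸ d)) (+-comm (x ∸ y) (y ∸ x))

-- Without wrap-around the two residues differ by `d`; with wrap-around they differ by `n ∸ d` in
-- the other direction, which has the same class.
differenceClass-% : ∀ n .{{_ : NonZero n}} {r d} → r < n → 0 < d → d < n →
                    differenceClass n ((r + d) % n) r ≡ d * (n ∸ d)
differenceClass-% n {r} {d} r<n 0<d d<n with r + d <? n
... | yes r+d<n = begin
  differenceClass n ((r + d) % n) r   ≡⟨ cong (λ x → differenceClass n x r) (m<n⇒m%n≡m r+d<n) ⟩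
  differenceClass n (r + d) r         ≡⟨ cong (λ e → e * (n ∸ e)) (trans (cong₂ _+_ (m+n∸m≡n r d) (m≤n⇒m∸n≡0 (m≤m+n r d))) (+-identityʳ d)) ⟩
  d * (n ∸ d)                         ∎
  where open ≡-Reasoning
... | no r+d≮n = begin
  differenceClass n ((r + d) % n) r   ≡⟨ cong (λ x → differenceClass n x r) wrapped ⟩
  differenceClass n x r               ≡⟨ cong (λ e → e * (n ∸ e)) (cong₂ _+_ (m≤n⇒m∸n≡0 x≤r) r∸x≡n∸d) ⟩
  (n ∸ d) * (n ∸ (n ∸ d))             ≡⟨ cong ((n ∸ d) *_) (m∸[m∸n]≡n (<⇒≤ d<n)) ⟩
  (n ∸ d) * d                         ≡⟨ *-comm (n ∸ d) d ⟩
  d * (n ∸ d)                         ∎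
  where
  open ≡-Reasoning
  n≤r+d = ≮⇒≥ r+d≮n
  x = r + d ∸ n
  r≡x+[n∸d] : r ≡ x + (n ∸ d)
  r≡x+[n∸d] = +-cancelʳ-≡ d _ _ (begin
    r + d              ≡⟨ m∸n+n≡m n≤r+d ⟨
    x + n              ≡⟨ cong (x +_) (m∸n+n≡m (<⇒≤ d<n)) ⟨
    x + (n ∸ d + d)    ≡⟨ +-assoc x (n ∸ d) d ⟨
    x + (n ∸ d) + d    ∎)
  x≤r : x ≤ r
  x≤r = ≤-trans (m≤m+n x (n ∸ d)) (≤-reflexive (sym r≡x+[n∸d]))
  r∸x≡n∸d : r ∸ x ≡ n ∸ d
  r∸x≡n∸d = trans (cong (_∸ x) r≡x+[n∸d]) (m+n∸m≡n x (n ∸ d))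
  wrapped : (r + d) % n ≡ x
  wrapped = trans (sym (m≤n⇒[n∸m]%m≡n%m n≤r+d)) (m<n⇒m%n≡m (≤-<-trans x≤r r<n))

-- The number of pairs meeting a set of k points, among k + c points.
pairs : ℕ → ℕ → ℕ
pairs c zero    = 0
pairs c (suc k) = c + pairs (suc c) k

module Search (n h : ℕ) where

  private
    class = differenceClass n

  -- us lists the classes met so far; b is the number of repetitions that can still
  -- be afforded.
  record-all : List ℕ → List ℕ → ℕ → (List ℕ → ℕ → Bool) → Bool
  record-all []       us b κ = κ us b
  record-all (d ∷ ds) us b       κ with any (d ≡ᵇ_) us
  record-all (d ∷ ds) us b       κ | false = record-all ds (d ∷ us) b κ
  -- `true` means refuted: a repetition that cannot be afforded closes the branch.
  record-all (d ∷ ds) us zero    κ | true  = true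
  record-all (d ∷ ds) us (suc b) κ | true  = record-all ds us b κ

  -- True only if every choice of at most k of the given candidates, added to the
  -- points cs, fails to meet h classes.
  refute : List ℕ → ℕ → List ℕ → List ℕ → ℕ → Bool
  refute []       _       cs us b = length us <ᵇ h
  refute (_ ∷ _)  zero    cs us b = length us <ᵇ h
  refute (x ∷ xs) (suc k) cs us b =
    refute xs (suc k) cs us b ∧ record-all (map (class x) cs) us b (refute xs k (x ∷ cs))

  module Soundness {targets : List ℕ} (unique : Unique targets) (length-targets : length targets ≡ h) where

    -- future lists the classes still to come.  A class recorded in us leaves the sum of
    -- the lengths unchanged, and a repeated one lowers it by one, to be paid from b.
    Coverable : List ℕ → List ℕ → ℕ → Set
    Coverable us future b = targets ⊆ us ++ future × length us + length future ≤ h + b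

    h≤ : ∀ us future {b} → Coverable us future b → h ≤ length us + length future
    h≤ us future (cover , _) = begin
      h                         ≡⟨ length-targets ⟨
      length targets            ≤⟨ unique⊆⇒length≤ unique cover ⟩
      length (us ++ future)     ≡⟨ length-++ us ⟩
      length us + length future ∎
      where open ≤-Reasoning

    record-all-sound : ∀ ds us b κ future →
      (∀ us b → Coverable us future b → ¬ T (κ us b)) →
      Coverable us (ds ++ future) b → ¬ T (record-all ds us b κ)
    record-all-sound []       us b κ future κ-sound coverable = κ-sound us b coverable
    record-all-sound (d ∷ ds) us b κ future κ-sound (cover , budget) = step b budget
      where
      budget⁻ : ∀ {b} → length us + length (d ∷ ds ++ future) ≤ h + b → suc (length us + length (ds ++ future)) ≤ h + b
      budget⁻ = ≤-trans (≤-reflexive (sym (+-suc (length us) _)))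
      move : us ++ d ∷ ds ++ future ⊆ d ∷ us ++ ds ++ future
      move v∈ with ∈-++⁻ us v∈
      ... | inj₁ v∈us       = there (∈-++⁺ˡ v∈us)
      ... | inj₂ (here v≡d) = here v≡d
      ... | inj₂ (there v∈) = there (∈-++⁺ʳ us v∈)
      drop : d ∈ us → us ++ d ∷ ds ++ future ⊆ us ++ ds ++ future
      drop d∈us v∈ with move v∈
      ... | here refl = ∈-++⁺ˡ d∈us
      ... | there v∈  = v∈
      step : ∀ b → length us + length (d ∷ ds ++ future) ≤ h + b → ¬ T (record-all (d ∷ ds) us b κ)
      step b budget with any (d ≡ᵇ_) us in eq
      step b budget | false = record-all-sound ds (d ∷ us) b κ future κ-sound (move ∘ cover , budget⁻ budget)
      step b budget | true with Any.map (≡ᵇ⇒≡ d _) (any⁻ (d ≡ᵇ_) us (Equivalence.from T-≡ eq))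
      -- Without the repeated class fewer than `h` places remain for the `h` targets.
      step zero budget | true | d∈us = λ _ → <⇒≱ (≤-trans (budget⁻ budget) (≤-reflexive (+-identityʳ h)))
        (h≤ us (ds ++ future) {0} (drop d∈us ∘ cover , <⇒≤ (budget⁻ budget)))
      step (suc b) budget | true | d∈us = record-all-sound ds us b κ future κ-sound
        (drop d∈us ∘ cover , s≤s⁻¹ (≤-trans (budget⁻ budget) (≤-reflexive (+-suc h b))))

    module _ {P : Pred ℕ 0ℓ} (P? : Decidable P) where

      -- The classes of the pairs formed by a candidate in P with an earlier candidate in
      -- P or a point of cs.
      future : List ℕ → List ℕ → List ℕ
      future []       cs = []
      future (x ∷ xs) cs with P? x
      ... | yes _ = map (class x) cs ++ future xs (x ∷ cs)
      ... | no _  = future xs cs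

      future-accept : ∀ {x xs cs} → P x → future (x ∷ xs) cs ≡ map (class x) cs ++ future xs (x ∷ cs)
      future-accept {x} px with P? x
      ... | yes _  = refl
      ... | no ¬px = contradiction px ¬px

      -- Follows the branch that takes exactly the candidates in `P`. `Coverable` persists along it,
      -- so at its end at least `h` classes have been met.
      refute-sound : ∀ xs k cs us b → length (filter P? xs) ≤ k →
                     Coverable us (future xs cs) b → ¬ T (refute xs k cs us b)
      refute-sound []       k cs us b _ coverable t =
        <⇒≱ (<ᵇ⇒< _ _ t) (≤-trans (h≤ us [] {b} coverable) (≤-reflexive (+-identityʳ _)))
      refute-sound (x ∷ xs) k cs us b bound coverable t with P? x
      refute-sound (x ∷ xs) (suc k) cs us b bound coverable t | no _ =
        refute-sound xs (suc k) cs us b bound coverable (proj₁ (Equivalence.to T-∧ t))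
      refute-sound (x ∷ xs) (suc k) cs us b bound coverable t | yes _ =
        record-all-sound (map (class x) cs) us b (refute xs k (x ∷ cs)) (future xs (x ∷ cs))
          (λ us b → refute-sound xs k (x ∷ cs) us b (s≤s⁻¹ bound)) coverable
          (proj₂ (Equivalence.to (T-∧ {refute xs (suc k) cs us b}) t))
      -- The bound 0 leaves no candidate in `P`, so no class is still to come.
      refute-sound (x ∷ xs) zero cs us b bound coverable t | no _ =
        <⇒≱ (<ᵇ⇒< _ _ t) (≤-trans (h≤ us (future xs cs) {b} coverable)
          (≤-reflexive (trans (cong (λ l → length us + length l) (future-none xs (n≤0⇒n≡0 bound))) (+-identityʳ _))))
        where
        future-none : ∀ xs {cs} → length (filter P? xs) ≡ 0 → future xs cs ≡ []
        future-none []       _  = refl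
        future-none (x ∷ xs) eq with P? x
        ... | no _ = future-none xs eq

      length-future : ∀ xs cs k → length (filter P? xs) ≤ k → length (future xs cs) ≤ pairs (length cs) k
      length-future []       cs k       _ = z≤n
      length-future (x ∷ xs) cs k       bound with P? x
      length-future (x ∷ xs) cs k       bound | no _ = length-future xs cs k bound
      length-future (x ∷ xs) cs (suc k) bound | yes _ = begin
        length (map (class x) cs ++ future xs (x ∷ cs))          ≡⟨ length-++ (map (class x) cs) ⟩
        length (map (class x) cs) + length (future xs (x ∷ cs))  ≤⟨ +-mono-≤ (≤-reflexive (length-map (class x) cs))
                                                                       (length-future xs (x ∷ cs) k (s≤s⁻¹ bound)) ⟩
        length cs + pairs (suc (length cs)) k                    ∎
        where open ≤-Reasoning

      ∈-future : ∀ xs {cs x y} → P x → x ∈ xs → y ∈ cs → class x y ∈ future xs cs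
      ∈-future (z ∷ xs) px x∈ y∈cs with P? z
      ∈-future (z ∷ xs) px (here refl) y∈cs | yes _  = ∈-++⁺ˡ (∈-map⁺ (class z) y∈cs)
      ∈-future (z ∷ xs) px (here refl) y∈cs | no ¬pz = contradiction px ¬pz
      ∈-future (z ∷ xs) {cs} px (there x∈) y∈cs | yes _ = ∈-++⁺ʳ (map (class z) cs) (∈-future xs px x∈ (there y∈cs))
      ∈-future (z ∷ xs) px (there x∈) y∈cs | no _    = ∈-future xs px x∈ y∈cs

      -- Whichever of `x` and `y` comes first in the list has become a point of `cs` by the time the
      -- other is met, so `∈-future` applies.
      ∈-future₂ : ∀ xs {cs x y} → P x → P y → x ≢ y → x ∈ xs → y ∈ xs → class x y ∈ future xs cs
      ∈-future₂ (z ∷ xs) px py x≢y (here refl) (here refl) = contradiction refl x≢y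
      ∈-future₂ (z ∷ xs) {cs} {x} {y} px py x≢y (here refl) (there y∈) with P? z
      ... | yes _  = ∈-++⁺ʳ (map (class z) cs) (subst (_∈ future xs (z ∷ cs)) (differenceClass-comm n y x) (∈-future xs py y∈ (here refl)))
      ... | no ¬pz = contradiction px ¬pz
      ∈-future₂ (z ∷ xs) {cs} px py x≢y (there x∈) (here refl) with P? z
      ... | yes _  = ∈-++⁺ʳ (map (class z) cs) (∈-future xs px x∈ (here refl))
      ... | no ¬pz = contradiction py ¬pz
      ∈-future₂ (z ∷ xs) {cs} px py x≢y (there x∈) (there y∈) with P? z
      ... | yes _ = ∈-++⁺ʳ (map (class z) cs) (∈-future₂ xs px py x≢y x∈ y∈)
      ... | no _  = ∈-future₂ xs px py x≢y x∈ y∈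

differenceClasses : ℕ → ℕ → List ℕ
differenceClasses n h = applyUpTo (λ i → suc i * (n ∸ suc i)) h

-- The points 0 and 1 are already chosen and their class recorded. There are `suc (pairs 2 k)` pairs
-- among `2 + k` points; the excess over `h` is the budget for repetitions.
refutes : ℕ → ℕ → ℕ → Bool
refutes n k h = refute xs k (1 ∷ 0 ∷ []) (differenceClass n 1 0 ∷ []) (suc (pairs 2 k) ∸ h)
  where
  open Search n h
  xs = applyUpTo (2 +_) (n ∸ 2)

ClassCovered : ℕ → Pred ℕ 0ℓ → ℕ → Set
ClassCovered n P d = ∃₂ λ x y → P x × P y × x < n × y < n × x ≢ y × differenceClass n x y ≡ d * (n ∸ d)

module _ {n′ k h : ℕ} (unique : Unique (differenceClasses (2 + n′) h))
  {P : Pred ℕ 0ℓ} (P? : Decidable P) (P0 : P 0) (P1 : P 1)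
  (size : length (filter P? (upTo (2 + n′))) ≤ 2 + k)
  (covers : ∀ d → 0 < d → d ≤ h → ClassCovered (2 + n′) P d)
  where

  private
    n = 2 + n′
    open Search n h
    open Soundness unique (length-applyUpTo (λ i → suc i * (n ∸ suc i)) h)
    xs = applyUpTo (2 +_) n′

    xs-size : length (filter P? xs) ≤ k
    xs-size = s≤s⁻¹ (s≤s⁻¹ (≤-trans (≤-reflexive (sym (cong length accept))) size))
      where
      accept : filter P? (upTo n) ≡ 0 ∷ 1 ∷ filter P? xs
      accept = trans (filter-accept P? P0) (cong (0 ∷_) (filter-accept P? P1))

    future-upTo : future P? (upTo n) [] ≡ differenceClass n 1 0 ∷ future P? xs (1 ∷ 0 ∷ [])
    future-upTo = trans (future-accept P? P0) (future-accept P? P1)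

    cover : differenceClasses n h ⊆ differenceClass n 1 0 ∷ future P? xs (1 ∷ 0 ∷ [])
    cover v∈ with ∈-applyUpTo⁻ _ v∈
    ... | i , i<h , refl with covers (suc i) (s≤s z≤n) i<h
    ...   | x , y , px , py , x<n , y<n , x≢y , eq =
      subst₂ _∈_ eq future-upTo (∈-future₂ P? (upTo n) px py x≢y (∈-upTo⁺ x<n) (∈-upTo⁺ y<n))

  refutes-sound : ¬ T (refutes n k h)
  refutes-sound = refute-sound P? xs k (1 ∷ 0 ∷ []) (differenceClass n 1 0 ∷ []) (suc (pairs 2 k) ∸ h) xs-size
    ( cover
    , ≤-trans (s≤s (length-future P? xs (1 ∷ 0 ∷ []) k xs-size)) (m≤n+m∸n (suc (pairs 2 k)) h)
    )

-- Reduction of cyclic groups to the search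

module _ {n′ k : ℕ} {_∙_ : Op₂ (Fin (2 + n′))} {ε : Fin (2 + n′)} {_⁻¹ : Op₁ (Fin (2 + n′))}
  (isAbelianGroup : IsAbelianGroup _≡_ _∙_ ε _⁻¹) where

  open FinGroup isAbelianGroup
  private
    n = 2 + n′

  x-z-[y-z]≡x-y : ∀ x y z → (x - z) - (y - z) ≡ x - y
  x-z-[y-z]≡x-y x y z = begin
    (x - z) ∙ ((y - z) ⁻¹)        ≡⟨ cong ((x - z) ∙_) (⁻¹-anti-homo‿- y z) ⟩
    (x ∙ (z ⁻¹)) ∙ (z - y)        ≡⟨ assoc x _ _ ⟩
    x ∙ ((z ⁻¹) ∙ (z - y))        ≡⟨ cong (x ∙_) (assoc _ _ _) ⟨
    x ∙ (((z ⁻¹) ∙ z) ∙ (y ⁻¹))   ≡⟨ cong (λ e → x ∙ (e ∙ (y ⁻¹))) (inverseˡ z) ⟩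
    x ∙ (ε ∙ (y ⁻¹))              ≡⟨ cong (x ∙_) (identityˡ _) ⟩
    x - y                         ∎
    where open ≡-Reasoning

  -- Discrete logarithms to the base `y` turn a translate of S into a set of exponents modulo `N`
  -- meeting the hypotheses of `refutes-sound`.
  cyclic-refuted : (s : Fin (2 + k) → Fin n) → (∀ g → ∃₂ λ i j → g ≡ s i - s j) →
                   ∀ {N} → n ≡ N → ∀ {y} → HasOrder y N →
                   ∀ h → h < N → Unique (differenceClasses N h) → refutes N k h ≢ true
  cyclic-refuted s covers refl {y} y-order h h<n unique refuted =
    refutes-sound unique P? P0 P1 size class-covers (Equivalence.from T-≡ refuted)
    where
    open Covering isAbelianGroup s covers
    -- With multiplier 1 the residue of an element is its discrete logarithm to the base `y`.
    open Residues 1 n {y} (y , ×-homo-1 y) y-order (count≤ (image? 1))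
    -- The generator `y` is itself a difference of S; translation by its second term gives the two
    -- terms the exponents 1 and 0.
    unit origin : Fin (2 + k)
    unit   = proj₁ (covers y)
    origin = proj₁ (proj₂ (covers y))

    -- The exponents of S, translated so as to contain 0 · y and 1 · y.
    ρ : Fin (2 + k) → ℕ
    ρ i = toℕ (residue (s i - s origin))

    P : Pred ℕ 0ℓ
    P x = ∃ λ i → ρ i ≡ x
    P? : Decidable P
    P? x = any? λ i → ρ i ℕ.≟ x

    P0 : P 0
    P0 = origin , cong toℕ (residue-unique {s origin - s origin} 0 (trans (×-homo-1 _) (inverseʳ _)))

    P1 : P 1
    P1 = unit , trans
      (cong toℕ (residue-unique {s unit - s origin} 1 (cong (1 ·_) (sym (proj₂ (proj₂ (covers y)))))))
      (toℕ-fromℕ< (m%n<n 1 n))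

    size : length (filter P? (upTo n)) ≤ 2 + k
    size = ≤-trans
      (unique⊆⇒length≤ {ys = tabulate ρ} (Unique.filter⁺ P? (Unique.upTo⁺ n))
        λ v∈ → let i , eq = proj₂ (∈-filter⁻ P? {xs = upTo n} v∈) in subst (_∈ tabulate ρ) eq (∈-tabulate⁺ {f = ρ} i))
      (≤-reflexive (length-tabulate ρ))

    class-covers : ∀ d → 0 < d → d ≤ h → ClassCovered n P d
    class-covers d 0<d d≤h with covers (d · y)
    ... | i , j , d·y≡ = ρ i , ρ j , (i , refl) , (j , refl) ,
      toℕ<n (residue (s i - s origin)) , toℕ<n (residue (s j - s origin)) , ρi≢ρj , class≡
      where
      d<n : d < n
      d<n = ≤-<-trans d≤h h<n
      ρi≡ : ρ i ≡ (ρ j + d) % n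
      ρi≡ = trans
        (cong toℕ (residue-- {s i - s origin} {s j - s origin} d
          (trans (×-homo-1 _) (trans (x-z-[y-z]≡x-y (s i) (s j) (s origin)) (sym d·y≡)))))
        (toℕ-fromℕ< (m%n<n (ρ j + d) n))
      class≡ : differenceClass n (ρ i) (ρ j) ≡ d * (n ∸ d)
      class≡ = trans (cong (λ x → differenceClass n x (ρ j)) ρi≡) (differenceClass-% n (toℕ<n (residue (s j - s origin))) 0<d d<n)
      ρi≢ρj : ρ i ≢ ρ j
      -- Equal exponents would have class 0, but `d * (n ∸ d)` is positive.
      ρi≢ρj eq = <⇒≢ (*-mono-< 0<d (m<n⇒0<n∸m d<n)) (begin
        0                              ≡⟨ cong (λ e → e * (n ∸ e)) (cong₂ _+_ (n∸n≡0 (ρ j)) (n∸n≡0 (ρ j))) ⟨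
        differenceClass n (ρ j) (ρ j)  ≡⟨ cong (λ x → differenceClass n x (ρ j)) eq ⟨
        differenceClass n (ρ i) (ρ j)  ≡⟨ class≡ ⟩
        d * (n ∸ d)                    ∎)
        where open ≡-Reasoning

refuted-40 : refutes 40 5 20 ≡ true
refuted-40 = refl

refuted-41 : refutes 41 5 20 ≡ true
refuted-41 = refl

refuted-43 : refutes 43 5 21 ≡ true
refuted-43 = refl

unique-40 : Unique (differenceClasses 40 20)
unique-40 = from-yes (unique? ℕ._≟_ (differenceClasses 40 20))

unique-41 : Unique (differenceClasses 41 20)
unique-41 = from-yes (unique? ℕ._≟_ (differenceClasses 41 20))

unique-43 : Unique (differenceClasses 43 21)
unique-43 = from-yes (unique? ℕ._≟_ (differenceClasses 43 21))

-- The orders 40 to 43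

-- 2ab ≥ 21 with a + b = 7 leaves only 3 and 4, where a² + b² = 25. The bound 27 is 1 + 21 + 5 from
-- `kernel≤autocorrelation₀` with a kernel of order 21.
no-autocorrelation₂ : (a : Fin 2 → ℕ) → sum a ≡ 7 → ¬ (27 ≤ autocorrelation a 0 × 21 ≤ autocorrelation a 1)
no-autocorrelation₂ a eq = check {a 0F} (s≤s (≤-trans (m≤m+n (a 0F) _) (≤-reflexive eq))) (begin
  a 1F                       ≡⟨ +-identityʳ (a 1F) ⟨
  a 1F + 0                   ≡⟨ m+n∸m≡n (a 0F) (a 1F + 0) ⟨
  a 0F + (a 1F + 0) ∸ a 0F   ≡⟨ cong (_∸ a 0F) eq ⟩
  7 ∸ a 0F                   ∎)
  where
  open ≡-Reasoning
  check : ∀ {a b} → a < 8 → b ≡ 7 ∸ a → ¬ (27 ≤ a * a + (b * b + 0) × 21 ≤ a * b + (b * a + 0))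
  check a<8 refl = from-yes (allUpTo? (λ a → let b = 7 ∸ a in
    ¬? ((27 ≤? a * a + (b * b + 0)) ×-dec (21 ≤? a * b + (b * a + 0)))) 8) a<8

-- Here 17 = 4 + 8 + 5 comes from `kernel≤autocorrelation₀` with a kernel of order 8. Shifts 3 and 4
-- mirror 2 and 1, and 17 + 4 · 8 = 7², so all bounds would be equalities; the finite check excludes
-- them.
no-autocorrelation₅ : (a : Fin 5 → ℕ) → sum a ≡ 7 →
                      ¬ (17 ≤ autocorrelation a 0 × 8 ≤ autocorrelation a 1 × 8 ≤ autocorrelation a 2)
no-autocorrelation₅ a eq =
  let a≤ , eq = rest {a 0F} eq
      b≤ , eq = rest {a 1F} eq
      c≤ , eq = rest {a 2F} eq
      d≤ , eq = rest {a 3F} eq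
  in subst (λ e → ¬ Autocorrelations (a 0F) (a 1F) (a 2F) (a 3F) e) (trans (sym eq) (+-identityʳ (a 4F)))
       (check (s≤s a≤) {a 1F} (s≤s b≤) {a 2F} (s≤s c≤) {a 3F} (s≤s d≤))
  where
  Autocorrelations : (a b c d e : ℕ) → Set
  Autocorrelations a b c d e =
    17 ≤ a * a + (b * b + (c * c + (d * d + (e * e + 0)))) ×
    8  ≤ a * b + (b * c + (c * d + (d * e + (e * a + 0)))) ×
    8  ≤ a * c + (b * d + (c * e + (d * a + (e * b + 0))))
  autocorrelations? : ∀ a b c d e → Dec (Autocorrelations a b c d e)
  autocorrelations? a b c d e = (_ ≤? _) ×-dec (_ ≤? _) ×-dec (_ ≤? _)
  rest : ∀ {x y z} → x + y ≡ z → x ≤ z × y ≡ z ∸ x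
  rest {x} {y} refl = m≤m+n x y , sym (m+n∸m≡n x y)
  check : ∀ {a} → a < 8 → ∀ {b} → b < suc (7 ∸ a) → ∀ {c} → c < suc (7 ∸ a ∸ b) → ∀ {d} → d < suc (7 ∸ a ∸ b ∸ c) →
          ¬ Autocorrelations a b c d (7 ∸ a ∸ b ∸ c ∸ d)
  check = from-yes
    (allUpTo? (λ a → allUpTo? (λ b → allUpTo? (λ c → allUpTo? (λ d →
      ¬? (autocorrelations? a b c d (7 ∸ a ∸ b ∸ c ∸ d)))
      (suc (7 ∸ a ∸ b ∸ c))) (suc (7 ∸ a ∸ b))) (suc (7 ∸ a))) 8)

-- The prime 5 divides none of `t`, `a`, `b`, so it divides the odd factor, and `t * a * b` is 8.
-- Then either `t` is 4 or all three are 2.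
factor-40 : ∀ {t} → t < 5 → ∀ {a} → a < suc t → ∀ {b} → b < suc t → ∀ {k} → k < 20 →
            40 ≡ t * a * b * (1 + 2 * k) → t * a * b ≡ 8 × (t ≡ 4 ⊎ t * a ≡ 4)
factor-40 = from-yes (allUpTo? (λ t → allUpTo? (λ a → allUpTo? (λ b → allUpTo? (λ k →
  (40 ℕ.≟ t * a * b * (1 + 2 * k)) →-dec ((t * a * b ℕ.≟ 8) ×-dec ((t ℕ.≟ 4) ⊎-dec (t * a ℕ.≟ 4)))) 20) (suc t)) (suc t)) 5)

MaximalDivisors : ℕ → List ℕ → Set
MaximalDivisors q ds = ∀ {g} → g < q → g ∣ q → Any (g ∣_) ds

maximalDivisors? : ∀ q ds → Dec (MaximalDivisors q ds)
maximalDivisors? q ds = allUpTo? (λ g → (g ∣? q) →-dec Any.any? (g ∣?_) ds) q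

maximal-2 : MaximalDivisors 2 (1 ∷ [])
maximal-2 = from-yes (maximalDivisors? 2 (1 ∷ []))

maximal-5 : MaximalDivisors 5 (1 ∷ [])
maximal-5 = from-yes (maximalDivisors? 5 (1 ∷ []))

maximal-41 : MaximalDivisors 41 (1 ∷ [])
maximal-41 = from-yes (maximalDivisors? 41 (1 ∷ []))

maximal-43 : MaximalDivisors 43 (1 ∷ [])
maximal-43 = from-yes (maximalDivisors? 43 (1 ∷ []))

-- These are 40 / 2 and 40 / 5, one for each prime factor.
maximal-40 : MaximalDivisors 40 (20 ∷ 8 ∷ [])
maximal-40 = from-yes (maximalDivisors? 40 (20 ∷ 8 ∷ []))

even-is-2 : ∀ {t} → 1 ≤ t → t ≤ 2 → ∀ j → 42 ≡ t + 2 * j → t ≡ 2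
even-is-2 {1} _ _ j eq = contradiction eq (even≢odd 21 j)
even-is-2 {2} _ _ j eq = refl
even-is-2 {suc (suc (suc _))} _ (s≤s (s≤s ()))

module _ {n′ : ℕ} {_∙_ : Op₂ (Fin (2 + n′))} {ε : Fin (2 + n′)} {_⁻¹ : Op₁ (Fin (2 + n′))}
  (isAbelianGroup : IsAbelianGroup _≡_ _∙_ ε _⁻¹) where

  open FinGroup isAbelianGroup
  private
    n = 2 + n′

  1≤kernel : ∀ m → 1 ≤ kernel m
  1≤kernel m = 0<count (λ x → m · x ≟ ε) (·ε m)

  1·≢ε : ∀ {x} → x ≢ ε → 1 · x ≢ ε
  1·≢ε x≢ε eq = x≢ε (trans (sym (×-homo-1 _)) eq)

  nontrivial : ∃ λ x → x ≢ ε
  nontrivial with ε ≟ zero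
  ... | yes refl = suc zero , λ ()
  ... | no ε≢0   = zero , ε≢0 ∘ sym

  kernel-<⇒∃ : ∀ a b → kernel a < kernel b → ∃ λ x → b · x ≡ ε × a · x ≢ ε
  kernel-<⇒∃ a b = count<⇒∃ (λ x → a · x ≟ ε) (λ x → b · x ≟ ε)

  ∃-outside-kernel : ∀ m → kernel m < n → ∃ λ x → m · x ≢ ε
  ∃-outside-kernel m lt =
    let x , _ , mx≢ε = count<⇒∃ (λ x → m · x ≟ ε) (λ x → x ≟ x)
                         (≤-trans lt (≤-reflexive (sym (count-all (λ x → x ≟ x) λ _ → refl))))
    in x , mx≢ε

  0<kernel-torsion : ∀ m → 1 ≤ count (λ g → (m · g ≟ ε) ×-dec (2 · g ≟ ε))
  0<kernel-torsion m = 0<count (λ g → (m · g ≟ ε) ×-dec (2 · g ≟ ε)) (·ε m , ·ε 2)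

  -- The fixed points of inversion are exactly the solutions of 2x = 0.
  kernel-2-parity : ∃ λ j → n ≡ kernel 2 + 2 * j
  kernel-2-parity = let j , eq = count-symmetric (λ x → x ≟ x) (λ _ → refl) in j , (begin
    n                                                  ≡⟨ count-all (λ x → x ≟ x) (λ _ → refl) ⟨
    count (λ x → x ≟ x)                                ≡⟨ eq ⟩
    count (λ x → (x ≟ x) ×-dec (x ⁻¹ ≟ x)) + 2 * j     ≡⟨ cong (_+ 2 * j) (count-cong (λ x → (x ≟ x) ×-dec (x ⁻¹ ≟ x)) (λ x → 2 · x ≟ ε)
                                                            (⁻¹≡⇒2·≡ε isAbelianGroup ∘ proj₂) (λ eq → refl , 2·≡ε⇒⁻¹≡ isAbelianGroup eq)) ⟩
    kernel 2 + 2 * j                                   ∎)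
    where open ≡-Reasoning

  -- An element of the image that is its own inverse is killed by 2 and by the coprime `q`, hence is
  -- `ε`; the others pair off with their inverses.
  image-odd : ∀ m q → gcd 2 q ≡ 1 → (∀ x → q · (m · x) ≡ ε) → ∃ λ j → count (image? m) ≡ 1 + 2 * j
  image-odd m q coprime qm≡ε = let j , eq = count-symmetric (image? m) image-⁻¹ in j , trans eq (cong (_+ 2 * j) (begin
    count (λ x → image? m x ×-dec (x ⁻¹ ≟ x))  ≡⟨ count-cong (λ x → image? m x ×-dec (x ⁻¹ ≟ x)) (λ x → ε ≟ x) only-ε (λ { refl → (ε , ·ε m) , ε⁻¹≈ε }) ⟩
    count (λ x → ε ≟ x)                        ≡⟨ sum-≟ ε ⟩
    1                                          ∎))
    where
    open ≡-Reasoning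
    image-⁻¹ : ∀ {x} → Image m x → Image m (x ⁻¹)
    image-⁻¹ (x , refl) = x ⁻¹ , ·-⁻¹ m x
    only-ε : ∀ {x} → Image m x × x ⁻¹ ≡ x → ε ≡ x
    only-ε {x} ((z , refl) , eq) = sym (trans (sym (×-homo-1 x)) (·-ε-gcd 2 q coprime (⁻¹≡⇒2·≡ε isAbelianGroup eq) (qm≡ε z)))

  module _ (s : Fin 7 → Fin n) (covers : ∀ g → ∃₂ λ i j → g ≡ s i - s j) where

    open Covering isAbelianGroup s covers

    n≤43 : n ≤ 43
    n≤43 = +-cancelˡ-≤ 6 n 43 (begin
      6 + n               ≡⟨ cong suc (+-comm 5 n) ⟩
      1 + (n + 5)         ≤⟨ +-monoˡ-≤ (n + 5) (1≤kernel 2) ⟩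
      kernel 2 + (n + 5)  ≤⟨ order-bound ⟩
      49                  ∎)
      where open ≤-Reasoning

    kernel-2≤ : ∀ {t} → t + (n + 5) ≡ 49 → kernel 2 ≤ t
    kernel-2≤ {t} eq = +-cancelʳ-≤ (n + 5) (kernel 2) t (≤-trans order-bound (≤-reflexive (sym eq)))

    -- When 1 is the only maximal proper divisor of the order, every nonzero element is a generator.
    prime-refuted : ∀ {N} → n ≡ N → MaximalDivisors N (1 ∷ []) →
                    ∀ h → h < N → Unique (differenceClasses N h) → refutes N 5 h ≢ true
    prime-refuted refl maximal =
      let y , y≢ε = nontrivial
      in cyclic-refuted isAbelianGroup s covers refl (hasOrder (1 ∷ []) maximal (order· y) (1·≢ε y≢ε ∷ []))

    n≢43 : n ≢ 43
    n≢43 n≡43 = prime-refuted n≡43 maximal-43 21 (m≤m+n 22 21) unique-43 refuted-43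

    n≢41 : n ≢ 41
    n≢41 n≡41 = prime-refuted n≡41 maximal-41 20 (m≤m+n 21 20) unique-41 refuted-41

    n≢42 : n ≢ 42
    n≢42 n≡42 = no-autocorrelation₂ occurrences sum-occurrences
        ( ≤-trans (+-mono-≤ (0<kernel-torsion 21) (≤-reflexive (cong (_+ 5) (sym kernel-21)))) kernel≤autocorrelation₀
        , ≤-trans (≤-reflexive (sym kernel-21)) (kernel≤autocorrelation 1))
      where
      -- `order-bound` leaves at most 2, and the parity of 42 excludes 1.
      kernel-2 : kernel 2 ≡ 2
      kernel-2 = let j , n≡ = kernel-2-parity in
        even-is-2 (1≤kernel 2) (kernel-2≤ (cong (λ z → 2 + (z + 5)) n≡42)) j (trans (sym n≡42) n≡)
      involution : ∃ λ x → 2 · x ≡ ε × x ≢ ε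
      involution =
        let x , 2x≡ε , ε≢x = count<⇒∃ (λ x → ε ≟ x) (λ x → 2 · x ≟ ε)
                               (≤-reflexive (trans (cong suc (sum-≟ ε)) (sym kernel-2)))
        in x , 2x≡ε , ε≢x ∘ sym
      h = proj₁ involution
      2h≡ε = proj₁ (proj₂ involution)
      -- 21h = h + 10 · 2h = h.
      h-image : Image 21 h
      h-image = h , trans (×-homo-+ h 1 20)
        (trans (cong₂ _∙_ (×-homo-1 h) (·-ε-∣ 2 20 (divides 10 refl) 2h≡ε)) (identityʳ h))
      -- Since 42x = 0, every 21x is one of the two solutions of 2y = 0.
      image≤2 : count (image? 21) ≤ 2
      image≤2 = ≤-trans
        (count-mono (image? 21) (λ x → 2 · x ≟ ε)
          λ { (x , refl) → trans (×-assocˡ x 2 21) (subst (λ z → z · x ≡ ε) n≡42 (order· x)) })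
        (≤-reflexive kernel-2)
      open Residues 21 2 h-image (hasOrder (1 ∷ []) maximal-2 2h≡ε (1·≢ε (proj₂ (proj₂ involution)) ∷ [])) image≤2
      kernel-21 : kernel 21 ≡ 21
      kernel-21 = *-cancelʳ-≡ (kernel 21) 21 2 (trans (sym kernel*q) n≡42)

    module Order40 (n≡40 : n ≡ 40) where

      40·≡ε : ∀ x → 40 · x ≡ ε
      40·≡ε x = subst (λ z → z · x ≡ ε) n≡40 (order· x)

      -- kernel 8 = kernel 2 * a * b with a, b ≤ kernel 2 ≤ 4, and 40 is kernel 8 times an
      -- odd number, the order of the image of 8; this forces kernel 8 = 8.
      a b : ℕ
      a = count (λ y → (2 · y ≟ ε) ×-dec image? 2 y)
      b = count (λ y → (2 · y ≟ ε) ×-dec image? 4 y)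

      kernel-4 : kernel 4 ≡ kernel 2 * a
      kernel-4 = kernel-* 2 2

      kernel-8 : kernel 8 ≡ kernel 2 * a * b
      kernel-8 = trans (kernel-* 2 4) (cong (_* b) kernel-4)

      orders : kernel 8 ≡ 8 × (kernel 2 ≡ 4 ⊎ kernel 4 ≡ 4)
      orders =
        -- Every 8x is killed by 5, so the image has odd order.
        let j , image≡ = image-odd 8 5 refl (λ x → ··-ε-∣ 40 5 8 (divides 1 refl) (40·≡ε x))
            40≡ = trans (sym n≡40) (trans (kernel*image 8) (cong₂ _*_ kernel-8 image≡))
            j<20 = *-cancelˡ-< 2 j 20 (≤-trans (≤-reflexive (sym image≡)) (≤-trans (count≤ (image? 8)) (≤-reflexive n≡40)))
            tab≡8 , cases = factor-40 (s≤s (kernel-2≤ (cong (λ z → 4 + (z + 5)) n≡40)))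
              (s≤s (count-mono (λ y → (2 · y ≟ ε) ×-dec image? 2 y) (λ y → 2 · y ≟ ε) proj₁))
              (s≤s (count-mono (λ y → (2 · y ≟ ε) ×-dec image? 4 y) (λ y → 2 · y ≟ ε) proj₁))
              j<20 40≡
        in trans kernel-8 tab≡8 , [ inj₁ , (λ ta≡4 → inj₂ (trans kernel-4 ta≡4)) ]′ cases

      outside : ∃ λ z → 8 · z ≢ ε
      outside = ∃-outside-kernel 8 (≤-trans (≤-reflexive (cong suc (proj₁ orders))) (≤-trans (m≤m+n 9 31) (≤-reflexive (sym n≡40))))

      z = proj₁ outside

      kernel-2≢4 : kernel 2 ≢ 4
      kernel-2≢4 kernel-2 = no-autocorrelation₅ occurrences sum-occurrences
          ( ≤-trans (≤-reflexive (sym (cong₂ _+_ torsion (cong (_+ 5) (proj₁ orders))))) kernel≤autocorrelation₀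
          , ≤-trans (≤-reflexive (sym (proj₁ orders))) (kernel≤autocorrelation 1)
          , ≤-trans (≤-reflexive (sym (proj₁ orders))) (kernel≤autocorrelation 2)
          )
        where
        image≤5 : count (image? 8) ≤ 5
        image≤5 = ≤-reflexive (*-cancelˡ-≡ (count (image? 8)) 5 8
          (trans (cong (_* count (image? 8)) (sym (proj₁ orders))) (trans (sym (kernel*image 8)) n≡40)))
        order-5 : HasOrder (8 · z) 5
        order-5 = hasOrder (1 ∷ []) maximal-5 (··-ε-∣ 40 5 8 (divides 1 refl) (40·≡ε z)) (1·≢ε (proj₂ outside) ∷ [])
        open Residues 8 5 (z , refl) order-5 image≤5
        -- A solution of 2g = 0 also satisfies 8g = 0, so all four lie in the kernel of 8.
        torsion : count (λ g → (8 · g ≟ ε) ×-dec (2 · g ≟ ε)) ≡ 4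
        torsion = trans
          (count-cong (λ g → (8 · g ≟ ε) ×-dec (2 · g ≟ ε)) (λ g → 2 · g ≟ ε) proj₂ (λ eq → ·-ε-∣ 2 8 (divides 4 refl) eq , eq))
          kernel-2

      module _ {x} (8x≡ε : 8 · x ≡ ε) (4x≢ε : 4 · x ≢ ε) where

        -- `x` has order 8 and `8 · z` has order 5, so their sum has order 40. It suffices to test
        -- the divisors 20 and 8.
        y : Fin n
        y = x ∙ (8 · z)

        -- 20 kills `8 · z`, so 20y = 0 gives 20x = 0; with 8x = 0 and gcd 4 this yields 4x = 0.
        20y≢ε : 20 · y ≢ ε
        20y≢ε 20y≡ε = 4x≢ε (·-ε-gcd 20 8 refl 20x≡ε 8x≡ε)
          where
          20x≡ε : 20 · x ≡ ε
          20x≡ε = trans (sym (·-∙-εʳ 20 x (8 · z) (··-ε-∣ 40 20 8 (divides 4 refl) (40·≡ε z)))) 20y≡ε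

        -- 8 kills `x`, so 8y = 0 gives 64z = 0; with 40z = 0 and gcd 8 this yields 8z = 0.
        8y≢ε : 8 · y ≢ ε
        8y≢ε 8y≡ε = proj₂ outside (·-ε-gcd 64 40 refl 64z≡ε (40·≡ε z))
          where
          64z≡ε : 64 · z ≡ ε
          64z≡ε = ··-ε⇒*-ε 8 8 refl (trans (sym (·-∙-εˡ 8 x (8 · z) 8x≡ε)) 8y≡ε)

        y-order : HasOrder y 40
        y-order = hasOrder (20 ∷ 8 ∷ []) maximal-40 (40·≡ε y) (20y≢ε ∷ 8y≢ε ∷ [])

      -- The kernel of 8 is larger than that of 4, which provides an element of order 8 and hence a
      -- generator.
      kernel-4≢4 : kernel 4 ≢ 4
      kernel-4≢4 kernel-4≡4 =
        let x , 8x≡ε , 4x≢ε = kernel-<⇒∃ 4 8 (≤-trans (≤-reflexive (cong suc kernel-4≡4))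
                                (≤-trans (m≤m+n 5 3) (≤-reflexive (sym (proj₁ orders)))))
        in cyclic-refuted isAbelianGroup s covers n≡40 (y-order 8x≡ε 4x≢ε) 20 (m≤m+n 21 19) unique-40 refuted-40

    n≢40 : n ≢ 40
    n≢40 n≡40 = [ kernel-2≢4 , kernel-4≢4 ]′ (proj₂ orders)
      where open Order40 n≡40

    n≤39 : n ≤ 39
    n≤39 = n≤43 ∖ n≢43 ∖ n≢42 ∖ n≢41 ∖ n≢40
      where
      infixl 5 _∖_
      _∖_ : ∀ {m} → n ≤ suc m → n ≢ suc m → n ≤ m
      n≤1+m ∖ n≢1+m = s≤s⁻¹ (≤∧≢⇒< n≤1+m n≢1+m)

-- Change of carrier and of universe levels

module Transport {c ℓ} (Γ : FiniteAbelianGroup c ℓ) where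

  open FiniteAbelianGroup Γ renaming (refl to ≈-refl; sym to ≈-sym; trans to ≈-trans)
  open Inverse enumeration

  private
    rawFin : RawGroup 0ℓ 0ℓ
    rawFin = record
      { Carrier = Fin order
      ; _≈_     = _≡_
      ; _∙_     = λ i j → from (to i ∙ to j)
      ; ε       = from ε
      ; _⁻¹     = λ i → from (to i ⁻¹)
      }

    module F = RawGroup rawFin

    to-injective : ∀ {i j} → to i ≈ to j → i ≡ j
    to-injective {i} {j} eq = trans (sym (strictlyInverseʳ i)) (trans (from-cong eq) (strictlyInverseʳ j))

    toMonomorphism : IsGroupMonomorphism rawFin rawGroup to
    toMonomorphism = record
      { isGroupHomomorphism = record
        { isMonoidHomomorphism = record
          { isMagmaHomomorphism = record
            { isRelHomomorphism = record { cong = to-cong }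
            ; homo              = λ _ _ → strictlyInverseˡ _
            }
          ; ε-homo = strictlyInverseˡ _
          }
        ; ⁻¹-homo = λ _ → strictlyInverseˡ _
        }
      ; injective = to-injective
      }

  -- The laws are pulled back along the injective homomorphism `to`, so the counting over `Fin`
  -- applies to an arbitrary finite carrier.
  isAbelianGroupFin : IsAbelianGroup _≡_ F._∙_ F.ε F._⁻¹
  isAbelianGroupFin = GroupMonomorphism.isAbelianGroup toMonomorphism isAbelianGroup

  module _ (S : List Carrier) where

    points : Fin (length S) → Fin order
    points i = from (lookup S i)

    points-cover : IsCoveringSet Γ S → ∀ g → ∃₂ λ i j → g ≡ points i F.∙ (points j F.⁻¹)
    points-cover covers g with covers (to g)
    ... | t , t′ , t∈S , t′∈S , g≈t-t′ = index t∈S , index t′∈S , to-injective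
      (≈-trans g≈t-t′ (≈-sym (≈-trans (strictlyInverseˡ _)
        (∙-cong (point t∈S) (≈-trans (strictlyInverseˡ _) (⁻¹-cong (point t′∈S)))))))
      where
      open Membership setoid using () renaming (_∈_ to _∈Γ_)
      point : ∀ {x} (x∈S : x ∈Γ S) → to (points (index x∈S)) ≈ x
      point x∈S = ≈-trans (strictlyInverseˡ _) (≈-sym (lookup-index x∈S))

module Lifting {c₀ ℓ₀} (Γ : FiniteAbelianGroup c₀ ℓ₀) (c ℓ : Level) where

  open FiniteAbelianGroup Γ renaming (refl to ≈-refl; sym to ≈-sym; trans to ≈-trans)

  private
    rawLift : RawGroup _ _
    rawLift = record
      { Carrier = Lift c Carrier
      ; _≈_ = λ x y → Lift ℓ (lower x ≈ lower y)
      ; _∙_ = λ x y → lift (lower x ∙ lower y)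
      ; ε   = lift ε
      ; _⁻¹ = λ x → lift (lower x ⁻¹)
      }

    lowerMonomorphism : IsGroupMonomorphism rawLift rawGroup lower
    lowerMonomorphism = record
      { isGroupHomomorphism = record
        { isMonoidHomomorphism = record
          { isMagmaHomomorphism = record
            { isRelHomomorphism = record { cong = lower }
            ; homo = λ _ _ → ≈-refl
            }
          ; ε-homo = ≈-refl
          }
        ; ⁻¹-homo = λ _ → ≈-refl
        }
      ; injective = lift
      }

  -- The maximum must be attained at arbitrary universe levels, whereas `ℤ/ 39` lives at level 0.
  liftGroup : FiniteAbelianGroup _ _
  liftGroup = record
    { abelianGroup = record
      { RawGroup rawLift
      ; isAbelianGroup = GroupMonomorphism.isAbelianGroup lowerMonomorphism isAbelianGroup
      }
    ; order = order
    ; enumeration = record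
      { to = λ i → lift (Inverse.to enumeration i)
      ; from = λ x → Inverse.from enumeration (lower x)
      ; to-cong = λ eq → lift (Inverse.to-cong enumeration eq)
      ; from-cong = λ eq → Inverse.from-cong enumeration (lower eq)
      ; inverse = (λ eq → lift (Inverse.inverseˡ enumeration eq)) , λ eq → Inverse.inverseʳ enumeration (lower eq)
      }
    }

  lift-HasSize : ∀ {S s} → HasSize Γ S s → HasSize liftGroup (map lift S) s
  lift-HasSize {S} (unique , size) =
    AllPairs.map⁺ (AllPairs.map (λ x≉y eq → x≉y (lower eq)) unique) , trans (length-map lift S) size

  lift-IsCoveringSet : ∀ {S} → IsCoveringSet Γ S → IsCoveringSet liftGroup (map lift S)
  lift-IsCoveringSet covers (lift g) =
    let t , t′ , t∈S , t′∈S , g≈t-t′ = covers g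
    in lift t , lift t′ , lift-∈ t∈S , lift-∈ t′∈S , lift g≈t-t′
    where
    lift-∈ = ∈ₛ-map⁺ setoid (FiniteAbelianGroup.setoid liftGroup) lift

module _ {c ℓ} (Γ : FiniteAbelianGroup c ℓ) where
  open FiniteAbelianGroup Γ
  open Membership setoid using (find) renaming (_∈_ to _∈Γ_)

  any-difference : ∀ {g S} → Any (λ t → Any (λ t′ → g ≈ t - t′) S) S →
                   ∃₂ λ t t′ → t ∈Γ S × t′ ∈Γ S × g ≈ t - t′
  any-difference any-t =
    let t  , t∈S  , any-t′ = find any-t
        t′ , t′∈S , g≈t-t′ = find any-t′
    in t , t′ , t∈S , t′∈S , g≈t-t′

-- The covering set of ℤ/39

S₃₉ : List (Fin 39)
S₃₉ = # 0 ∷ # 1 ∷ # 2 ∷ # 4 ∷ # 13 ∷ # 18 ∷ # 33 ∷ []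

open FiniteAbelianGroup (ℤ/ 39) using (_-_; ε)

-- By evaluation. The 42 differences of distinct elements fall on 38 nonzero residues: 34 · 1 + 4 ·
-- 2 = 42.
almostDifferenceSet : IsAlmostDifferenceSet (ℤ/ 39) S₃₉ 39 7 1 34
almostDifferenceSet = record
  { group-order = refl
  ; size = from-yes (allPairs? (λ x y → ¬? (x Fin.≟ y)) S₃₉) , refl
  ; exactly-t = refl
  ; λ-or-suc-λ = from-yes (Fin.all? λ g → ¬? (g Fin.≟ ε) →-dec
                   ((multiplicity (ℤ/ 39) g (differences (ℤ/ 39) S₃₉) ℕ.≟ 1) ⊎-dec
                    (multiplicity (ℤ/ 39) g (differences (ℤ/ 39) S₃₉) ℕ.≟ 2)))
  }

difference-in-S₃₉ : ∀ g → Any (λ t → Any (λ t′ → g ≡ t - t′) S₃₉) S₃₉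
difference-in-S₃₉ = from-yes (Fin.all? λ g → Any.any? (λ t → Any.any? (λ t′ → g Fin.≟ t - t′) S₃₉) S₃₉)

covering : IsCoveringSet (ℤ/ 39) S₃₉
covering g = any-difference (ℤ/ 39) (difference-in-S₃₉ g)

-- Orders 0 and 1 are split off because the argument for `n≤39` uses a group with at least two
-- elements.
order≤39 : ∀ {n} {_∙_ : Op₂ (Fin n)} {ε : Fin n} {_⁻¹ : Op₁ (Fin n)} → IsAbelianGroup _≡_ _∙_ ε _⁻¹ →
           ∀ {k} → k ≡ 7 → (s : Fin k → Fin n) → (∀ g → ∃₂ λ i j → g ≡ s i ∙ (s j ⁻¹)) → n ≤ 39
order≤39 {0}           _              _    _ _      = z≤n
order≤39 {1}           _              _    _ _      = s≤s z≤n
order≤39 {suc (suc n)} isAbelianGroup refl s covers = n≤39 isAbelianGroup s covers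

proposition3p2 : ∀ {c ℓ : Level} →
    let S : List (Fin 39)
        S = # 0 ∷ # 1 ∷ # 2 ∷ # 4 ∷ # 13 ∷ # 18 ∷ # 33 ∷ [] in
    IsMaximumOf (HasGroupWithCoveringSet c ℓ 7) 39 ×
    IsAlmostDifferenceSet (ℤ/ 39) S 39 7 1 34 ×
    IsCoveringSet (ℤ/ 39) S
proposition3p2 {c} {ℓ} = (attained , maximal) , almostDifferenceSet , covering
  where
  open Lifting (ℤ/ 39) c ℓ
  attained : HasGroupWithCoveringSet c ℓ 7 39
  attained = liftGroup , map lift S₃₉ , refl ,
    lift-HasSize (IsAlmostDifferenceSet.size almostDifferenceSet) , lift-IsCoveringSet covering
  maximal : ∀ m → HasGroupWithCoveringSet c ℓ 7 m → m ≤ 39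
  maximal _ (Γ , S , refl , (_ , size) , covers) = order≤39 isAbelianGroupFin size (points S) (points-cover S covers)
    where open Transport Γ
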